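{- For $b\geq0$, $k\geq1$, $\ell_1,\ldots,\ell_k\geq b$ and $f(r)$ any formal power series with $f'(0)\neq0$, $$\frac{\partial^kf(\hat R^{(b)})}{\partial\hat x_{\ell_1}\cdots\partial\hat x_{\ell_k}}(0,0,\ldots)=k!\,[z^k]\int_0^{J^{ -1}(b;z)}\mathrm dr\,f'(r)\prod_{i=1}^kI(b,\ell_i;r)$$ is a polynomial in $b,\ell_1^2,\ldots,\ell_k^2$ that is symmetric and of degree $k-1$ in $\ell_1^2,\ldots,\ell_k^2$.
   Context: Define the formal power series in $r$ $$I(b,\ell;r)=\sum_{p=0}^\infty\frac{r^p}{(p!)^2}\prod_{m=0}^{p-1}(\ell^2-(b-m)^2),\qquad J(b;r)=\sum_{p=1}^\infty\frac{(-1)^{p+1}r^p}{p!(p-1)!}\prod_{m=0}^{p-2}(b-m)(b-m-1),$$ and let $z\mapsto J^{ -1}(b;z)=z+\cdots$ be the compositional inverse of $r\mapsto J(b;r)=r+\cdots$. $\hat R^{(b)}(\hat x_b,\hat x_{b+1},\ldots)$ is the unique formal power series with zero constant term such that $J(b;\hat R^{(b)})-\sum_{\ell=b}^\infty I(b,\ell;\hat R^{(b)})\,\hat x_\ell=0$. $[z^k]$ denotes extraction of the coefficient of $z^k$. The numbers $b,\ell_1,\ldots,\ell_k$ are integers. -}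

module Defs where

open import Level using (_⊔_)
open import Algebra.Bundles using (CommutativeRing)
open import Data.Fin.Base using (Fin; toℕ)
open import Data.Fin.Permutation using (Permutation′; _⟨$⟩ʳ_)
open import Data.List.Base as List using (List; []; _∷_; _∷ʳ_)
import Data.Nat.ListAction as ListAction
open import Data.Nat.Base as ℕ using (ℕ; zero; suc; _∸_; _<_; NonZero; _!)
open import Data.Nat.Properties using (_!≢0)
import Data.Nat.Properties as ℕₚ
open import Data.Product.Base using (_×_; _,_; proj₁; Σ-syntax; ∃-syntax)
open import Data.Vec.Base as Vec using (Vec; []; _∷_)
open import Data.Vec.Functional as Vector using (Vector)
import Data.Vec.Properties as Vecₚ
open import Function.Base using (_∘_)
open import Relation.Binary.PropositionalEquality.Core using (_≡_)
open import Relation.Nullary.Decidable.Core using (does)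
open import Relation.Nullary.Negation.Core using (¬_)
open import Data.Bool.Base using (if_then_else_)
open import Algebra.Definitions using (Invertible)
import Algebra.Properties.CommutativeMonoid.Sum as Summation
import Algebra.Properties.Semiring.Exp as Exponentiation
import Algebra.Properties.Semiring.Mult as Multiples

-- K contains ℚ whenever every positive integer is a unit in K; for a field
-- this says that the characteristic is zero.
PositivesInvertible : ∀ {c r} → CommutativeRing c r → Set (c ⊔ r)
PositivesInvertible K =
  ∀ n → .{{NonZero n}} → Invertible _≈_ 1# _*_ (n · 1#)
  where
  open CommutativeRing K
  open Multiples semiring using () renaming (_×_ to _·_)

module Series {c r} (K : CommutativeRing c r) (inv : PositivesInvertible K) where

  open CommutativeRing K public
    using (Carrier; _≈_; _+_; _*_; _-_; -_; 0#; 1#)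
  private module K = CommutativeRing K
  open Multiples K.semiring public using () renaming (_×_ to _·_)
  open Exponentiation K.semiring public using (_^_)
  open Summation K.+-commutativeMonoid public
    using (sum; sum-syntax; sum⁺-syntax)
  open Summation K.*-commutativeMonoid public
    using () renaming (sum to prod)

  infixl 10 prod-syntax

  prod-syntax : ∀ n → Vector Carrier n → Carrier
  prod-syntax _ = prod

  syntax prod-syntax n (λ i → x) = ∏[ i < n ] x

  fromℕ : ℕ → Carrier
  fromℕ n = n · 1#

  recip : (n : ℕ) → .{{NonZero n}} → Carrier
  recip n = proj₁ (inv n)

  recip! : ℕ → Carrier
  recip! n = recip (n !) {{n !≢0}}

  ----------------------------------------------------------------------
  -- Formal power series in one variable; f n is the coefficient of rⁿ.

  FPS : Set c
  FPS = ℕ → Carrier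

  infixl 7 _⊛_
  infixr 8 _⊛^_
  infixr 9 _⟨_⟩

  1ₛ : FPS
  1ₛ zero    = 1#
  1ₛ (suc _) = 0#

  Xₛ : FPS
  Xₛ 1 = 1#
  Xₛ _ = 0#

  _⊛_ : FPS → FPS → FPS
  (f ⊛ g) n = ∑[ i ≤ n ] (f (toℕ i) * g (n ∸ toℕ i))

  _⊛^_ : FPS → ℕ → FPS
  f ⊛^ zero  = 1ₛ
  f ⊛^ suc n = f ⊛ (f ⊛^ n)

  ∏ₛ : ∀ {k} → Vector FPS k → FPS
  ∏ₛ = Vector.foldr _⊛_ 1ₛ

  -- Substitution f(g), meaningful when g has zero constant term: then gⁱ
  -- does not contribute to the coefficient of rⁿ for i > n.
  _⟨_⟩ : FPS → FPS → FPS
  (f ⟨ g ⟩) n = ∑[ i ≤ n ] (f (toℕ i) * (g ⊛^ toℕ i) n)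

  deriv : FPS → FPS
  deriv f n = fromℕ (suc n) * f (suc n)

  ∫₀ : FPS → FPS
  ∫₀ f zero    = 0#
  ∫₀ f (suc n) = recip (suc n) * f n

  IsCompositionalInverse : FPS → FPS → Set r
  IsCompositionalInverse f g =
    g 0 ≈ 0# × (∀ n → (f ⟨ g ⟩) n ≈ Xₛ n) × (∀ n → (g ⟨ f ⟩) n ≈ Xₛ n)

  ----------------------------------------------------------------------
  -- Formal power series in infinitely many variables y₀, y₁, y₂, …
  --
  -- The list e₀ ∷ … ∷ eₙ₋₁ ∷ [] stands for the monomial y₀^e₀ ⋯ yₙ₋₁^eₙ₋₁.
  -- Lists that differ by trailing zeros stand for the same monomial, so a
  -- coefficient function is a power series only if it respects padding.

  FPS∞ : Set c
  FPS∞ = List ℕ → Carrier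

  RespectsPadding : FPS∞ → Set r
  RespectsPadding F = ∀ e → F (e ∷ʳ 0) ≈ F e

  infixl 7 _⊛∞_
  infixr 8 _⊛∞^_
  infixr 9 _⟨_⟩∞
  infixr 7 y[_]·_

  1∞ : FPS∞
  1∞ []           = 1#
  1∞ (zero  ∷ es) = 1∞ es
  1∞ (suc _ ∷ es) = 0#

  -- F ∘ (i ∷_) is the coefficient of y₀ⁱ, a series in the other variables.
  _⊛∞_ : FPS∞ → FPS∞ → FPS∞
  (F ⊛∞ G) []       = F [] * G []
  (F ⊛∞ G) (e ∷ es) =
    ∑[ i ≤ e ] (((F ∘ (toℕ i ∷_)) ⊛∞ (G ∘ ((e ∸ toℕ i) ∷_))) es)

  _⊛∞^_ : FPS∞ → ℕ → FPS∞
  F ⊛∞^ zero  = 1∞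
  F ⊛∞^ suc n = F ⊛∞ (F ⊛∞^ n)

  -- Substitution f(F), meaningful when F has zero constant term: then Fⁱ
  -- does not contribute in total degree less than i.
  _⟨_⟩∞ : FPS → FPS∞ → FPS∞
  (f ⟨ F ⟩∞) e = ∑[ i ≤ ListAction.sum e ] (f (toℕ i) * (F ⊛∞^ toℕ i) e)

  -- The product of the variable yⱼ and the series F.
  y[_]·_ : ℕ → FPS∞ → FPS∞
  (y[ j     ]· F) []           = 0#
  (y[ zero  ]· F) (zero  ∷ es) = 0#
  (y[ zero  ]· F) (suc e ∷ es) = F (e ∷ es)
  (y[ suc j ]· F) (e ∷ es)     = (y[ j ]· (F ∘ (e ∷_))) es

  -- The sum over all j of yⱼ · Gⱼ; only variables that occur in the monomial
  -- contribute to its coefficient.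
  Σy : (ℕ → FPS∞) → FPS∞
  Σy G e = ∑[ j < List.length e ] ((y[ toℕ j ]· G (toℕ j)) e)

  exponent : ℕ → List ℕ → ℕ
  exponent j       []       = 0
  exponent zero    (e ∷ es) = e
  exponent (suc j) (e ∷ es) = exponent j es

  raise : ℕ → List ℕ → List ℕ
  raise zero    []       = 1 ∷ []
  raise zero    (e ∷ es) = suc e ∷ es
  raise (suc j) []       = 0 ∷ raise j []
  raise (suc j) (e ∷ es) = e ∷ raise j es

  ∂ : ℕ → FPS∞ → FPS∞
  ∂ j F e = fromℕ (suc (exponent j e)) * F (raise j e)

  at0 : FPS∞ → Carrier
  at0 F = F []

  ----------------------------------------------------------------------
  -- Polynomials in n variables, as lists of terms (coefficient , exponents).

  Polynomial : ℕ → Set c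
  Polynomial n = List (Carrier × Vec ℕ n)

  eval : ∀ {n} → Polynomial n → Vector Carrier n → Carrier
  eval {n} P x = List.foldr _+_ 0# (List.map term P)
    where
    term : Carrier × Vec ℕ n → Carrier
    term (a , e) = a * ∏[ i < n ] (x i ^ Vec.lookup e i)

  coeff : ∀ {n} → Polynomial n → Vec ℕ n → Carrier
  coeff {n} P e = List.foldr _+_ 0# (List.map pick P)
    where
    pick : Carrier × Vec ℕ n → Carrier
    pick (a , e′) = if does (Vecₚ.≡-dec ℕₚ._≟_ e′ e) then a else 0#

  -- For polynomials in a distinguished variable (the first one) and k
  -- further ones: symmetry and total degree in the latter.

  SymmetricInTail : ∀ {k} → Polynomial (suc k) → Set r
  SymmetricInTail {k} P = ∀ a (e : Vec ℕ k) (π : Permutation′ k) →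
    coeff P (a ∷ Vec.tabulate (λ i → Vec.lookup e (π ⟨$⟩ʳ i))) ≈ coeff P (a ∷ e)

  HasTailDegree : ∀ {k} → Polynomial (suc k) → ℕ → Set r
  HasTailDegree {k} P d =
    (∀ a (e : Vec ℕ k) → d < Vec.sum e → coeff P (a ∷ e) ≈ 0#) ×
    (∃[ a ] Σ[ e ∈ Vec ℕ k ] (Vec.sum e ≡ d × ¬ (coeff P (a ∷ e) ≈ 0#)))

  ----------------------------------------------------------------------

  I : ℕ → ℕ → FPS
  I b ℓ p = recip! p * recip! p *
    ∏[ m < p ] (fromℕ ℓ ^ 2 - (fromℕ b - fromℕ (toℕ m)) ^ 2)

  -- In the second clause p = suc q.
  J : ℕ → FPS
  J b zero    = 0#
  J b (suc q) = (- 1#) ^ (suc q ℕ.+ 1) * recip! (suc q) * recip! q *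
    ∏[ m < q ] ((fromℕ b - fromℕ (toℕ m)) * (fromℕ b - fromℕ (toℕ m) - 1#))

  -- R is the series R̂⁽ᵇ⁾, with the variable y j standing for x̂_{b+j}.
  IsR̂ : ℕ → FPS∞ → Set r
  IsR̂ b R =
    RespectsPadding R ×
    R [] ≈ 0# ×
    (∀ e → (J b ⟨ R ⟩∞) e - Σy (λ j → I b (b ℕ.+ j) ⟨ R ⟩∞) e ≈ 0#)

  -- ∂ᵏF / ∂x̂_{ℓ₁} ⋯ ∂x̂_{ℓₖ}, when F is a series in x̂_b, x̂_{b+1}, …
  ∂x̂ : ∀ {k} → ℕ → Vector ℕ k → FPS∞ → FPS∞
  ∂x̂ b ℓ F = Vector.foldr (λ ℓᵢ → ∂ (ℓᵢ ∸ b)) F ℓ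

  -- The series ∫₀^{J⁻¹(z)} dr f′(r) ∏ᵢ I(b,ℓᵢ;r) in z.
  integral : ∀ {k} → ℕ → Vector ℕ k → FPS → FPS → FPS
  integral b ℓ f J⁻¹ = ∫₀ (deriv f ⊛ ∏ₛ (λ i → I b (ℓ i))) ⟨ J⁻¹ ⟩

  b,ℓ² : ∀ {k} → ℕ → Vector ℕ k → Vector Carrier (suc k)
  b,ℓ² b ℓ = fromℕ b Vector.∷ (λ i → fromℕ (ℓ i) ^ 2)

{-# OPTIONS --safe #-}

-- Adjoin a variable w and solve J(F) = w + Σⱼ yⱼ φⱼ(F) with φⱼ = I(b,b+j).
-- Differentiating gives ∂F/∂yⱼ = φⱼ(F) ∂F/∂w, so ∂g(F)/∂yⱼ = ∂h(F)/∂w whenever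
-- h′ = g′ φⱼ.  Hence k derivatives in the yⱼ of f(F) become ∂ᵏ/∂wᵏ of h(F) with
-- h = ∫ f′ ∏ φⱼ.  For w = 0 the solution is R̂, and for y = 0 it is J⁻¹(w).
--
-- Write I(b,ℓ;r) = Σ_q ℓ^{2q} G_q(b;r), where G_q has order q in r.  The
-- coefficient of ∏ ℓᵢ^{2eᵢ} in the integral formula depends on e only through
-- ∏ G_{eᵢ}, which is symmetric and has order Σ eᵢ in r: it vanishes for
-- Σ eᵢ > k - 1, and for Σ eᵢ = k - 1 its value at b = 0 is a unit times f′(0).
-- It is a polynomial in b because the coefficients of G_q and J⁻¹ are.

module Submission where

open import Algebra.Bundles using (CommutativeRing; AbelianGroup)
open import Data.Nat.Base as ℕ using (ℕ; zero; suc; _∸_; _≤_; _<_; z≤n; s≤s; _!)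
import Data.Nat.Properties as ℕₚ
open import Data.Fin.Base as Fin using (Fin; toℕ)
import Data.Fin.Properties as Finₚ
import Data.Fin.Permutation as Perm
open Perm using (Permutation′; _⟨$⟩ʳ_)
open import Data.List.Base as List using (List; []; _∷_; _∷ʳ_; length)
import Data.List.Properties as Listₚ
import Data.Nat.ListAction as ListAction
open import Data.Product.Base using (_×_; _,_; proj₁; proj₂; Σ-syntax)
open import Data.Vec.Base as Vec using (Vec; []; _∷_)
import Data.Vec.Properties as Vecₚ
open import Data.Vec.Functional as Vector using (Vector)
open import Function.Base using (_∘_; _$_)
open import Relation.Binary.PropositionalEquality.Core as ≡ using (_≡_; _≢_)
open import Relation.Nullary.Negation.Core using (¬_; contradiction)
open import Relation.Nullary.Decidable using (Dec; yes; no; does; dec-true; dec-false)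
open import Relation.Binary.Definitions using (Tri; tri<; tri≈; tri>)
open import Data.Bool.Base using (if_then_else_)
import Algebra.Properties.CommutativeMonoid.Sum as Summation
import Algebra.Properties.Semiring.Sum as SemiringSum
import Algebra.Properties.CommutativeSemigroup as CommutativeSemigroupProperties
import Algebra.Properties.Ring as RingProperties
import Algebra.Properties.AbelianGroup as AbelianGroupProperties
import Algebra.Properties.Monoid.Mult as MonoidMult
import Relation.Binary.Reasoning.Setoid as SetoidReasoning
open import Level using (_⊔_)
import Algebra.Construct.Pointwise as Pointwise
import Algebra.Properties.Semiring.Mult as SemiringMult
open import Data.Sum.Base using (_⊎_; inj₁; inj₂)
open import Defs

private
  module ℕSum = Summation ℕₚ.+-0-commutativeMonoid

module Theory {c r} (K : CommutativeRing c r) (inv : PositivesInvertible K) where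

  open Series K inv
  open CommutativeRing K
    hiding (Carrier; _≈_; _+_; _*_; _-_; -_; 0#; 1#; zero)
    renaming (refl to ≈-refl; sym to ≈-sym; trans to ≈-trans)
  open SemiringSum semiring using
    ( *-distribˡ-sum; *-distribʳ-sum; ∑-distrib-+; sum-cong-≋
    ; sum-replicate-zero; sum-permute; ∑-comm)
  open SetoidReasoning setoid

  lsum : List ℕ → ℕ
  lsum = ListAction.sum

  ∑-cong : ∀ n {t u : Vector Carrier n} → (∀ i → t i ≈ u i) → sum t ≈ sum u
  ∑-cong n = sum-cong-≋ {n}

  ∑-zero : ∀ n {t : Vector Carrier n} → (∀ i → t i ≈ 0#) → sum t ≈ 0#
  ∑-zero n t≈0 = ≈-trans (∑-cong n t≈0) (sum-replicate-zero n)

  ∑-reverse : ∀ n (g : ℕ → ℕ → Carrier) →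
    ∑[ i ≤ n ] g (toℕ i) (n ∸ toℕ i) ≈ ∑[ i ≤ n ] g (n ∸ toℕ i) (toℕ i)
  ∑-reverse n g = begin
    ∑[ i ≤ n ] g (toℕ i) (n ∸ toℕ i)
      ≈⟨ sum-permute {suc n} {suc n} (λ i → g (toℕ i) (n ∸ toℕ i)) Perm.reverse ⟩
    ∑[ i ≤ n ] g (toℕ (Fin.opposite i)) (n ∸ toℕ (Fin.opposite i))
      ≈⟨ ∑-cong (suc n) (λ i → reflexive (≡.cong₂ g (Finₚ.opposite-prop i)
           (≡.trans (≡.cong (n ∸_) (Finₚ.opposite-prop i))
             (ℕₚ.m∸[m∸n]≡n (Finₚ.toℕ≤pred[n] i))))) ⟩
    ∑[ i ≤ n ] g (n ∸ toℕ i) (toℕ i) ∎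

  -- The ring of power series in infinitely many variables

  infix 4 _≋_

  _≋_ : FPS∞ → FPS∞ → Set r
  F ≋ G = ∀ e → F e ≈ G e

  0∞ : FPS∞
  0∞ _ = 0#

  infixl 6 _⊞_
  _⊞_ : FPS∞ → FPS∞ → FPS∞
  (F ⊞ G) e = F e + G e

  ⊟_ : FPS∞ → FPS∞
  (⊟ F) e = - F e

  ⊛-cong-split : ∀ {F F′ G G′} e →
    (∀ e₁ e₂ → length e₁ ≡ length e → length e₂ ≡ length e →
      lsum e₁ ℕ.+ lsum e₂ ≡ lsum e → F e₁ * G e₂ ≈ F′ e₁ * G′ e₂) →
    (F ⊛∞ G) e ≈ (F′ ⊛∞ G′) e
  ⊛-cong-split []       eq = eq [] [] ≡.refl ≡.refl ≡.refl
  ⊛-cong-split (e ∷ es) eq = ∑-cong (suc e) λ i → ⊛-cong-split es λ e₁ e₂ l₁ l₂ s →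
    eq (toℕ i ∷ e₁) (e ∸ toℕ i ∷ e₂) (≡.cong suc l₁) (≡.cong suc l₂)
      (≡.trans (ℕₚ.+-assoc (toℕ i) (lsum e₁) _) $
       ≡.trans (≡.cong (toℕ i ℕ.+_) (≡.trans (≡.sym (ℕₚ.+-assoc (lsum e₁) _ _))
         (≡.trans (≡.cong (ℕ._+ lsum e₂) (ℕₚ.+-comm (lsum e₁) _)) (ℕₚ.+-assoc (e ∸ toℕ i) _ _)))) $
       ≡.trans (≡.sym (ℕₚ.+-assoc (toℕ i) (e ∸ toℕ i) _))
         (≡.cong₂ ℕ._+_ (ℕₚ.m+[n∸m]≡n (Finₚ.toℕ≤pred[n] i)) s))

  ⊛-cong : ∀ {F F′ G G′} → F ≋ F′ → G ≋ G′ → F ⊛∞ G ≋ F′ ⊛∞ G′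
  ⊛-cong p q e = ⊛-cong-split e λ e₁ e₂ _ _ _ → *-cong (p e₁) (q e₂)

  ⊛-zeroˡ : ∀ F → 0∞ ⊛∞ F ≋ 0∞
  ⊛-zeroˡ F []       = zeroˡ _
  ⊛-zeroˡ F (e ∷ es) = ∑-zero (suc e) λ i → ⊛-zeroˡ (F ∘ (e ∸ toℕ i ∷_)) es

  ⊛-distribʳ : ∀ F G H → (G ⊞ H) ⊛∞ F ≋ (G ⊛∞ F) ⊞ (H ⊛∞ F)
  ⊛-distribʳ F G H []       = distribʳ _ _ _
  ⊛-distribʳ F G H (e ∷ es) =
    ≈-trans (∑-cong (suc e) λ i → ⊛-distribʳ (F ∘ (e ∸ toℕ i ∷_)) (G ∘ (toℕ i ∷_)) (H ∘ (toℕ i ∷_)) es)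
      (∑-distrib-+ {suc e}
        (λ i → ((G ∘ (toℕ i ∷_)) ⊛∞ (F ∘ (e ∸ toℕ i ∷_))) es)
        (λ i → ((H ∘ (toℕ i ∷_)) ⊛∞ (F ∘ (e ∸ toℕ i ∷_))) es))

  ⊛-comm : ∀ F G → F ⊛∞ G ≋ G ⊛∞ F
  ⊛-comm F G []       = *-comm _ _
  ⊛-comm F G (e ∷ es) = ≈-trans
    (∑-reverse e λ i j → ((F ∘ (i ∷_)) ⊛∞ (G ∘ (j ∷_))) es)
    (∑-cong (suc e) λ i → ⊛-comm (F ∘ (e ∸ toℕ i ∷_)) (G ∘ (toℕ i ∷_)) es)

  ⊛-distribˡ : ∀ F G H → F ⊛∞ (G ⊞ H) ≋ (F ⊛∞ G) ⊞ (F ⊛∞ H)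
  ⊛-distribˡ F G H e = ≈-trans (⊛-comm F _ e)
    (≈-trans (⊛-distribʳ F G H e) (+-cong (⊛-comm G F e) (⊛-comm H F e)))

  ⊛-distribˡ-sum : ∀ {n} F (G : Vector FPS∞ n) →
    F ⊛∞ (λ e → sum (λ i → G i e)) ≋ λ e → sum (λ i → (F ⊛∞ G i) e)
  ⊛-distribˡ-sum {zero}  F G e = ≈-trans (⊛-comm F 0∞ e) (⊛-zeroˡ F e)
  ⊛-distribˡ-sum {suc n} F G e =
    ≈-trans (⊛-distribˡ F (G Fin.zero) _ e) (+-congˡ (⊛-distribˡ-sum F (G ∘ Fin.suc) e))

  ⊛-distribʳ-sum : ∀ {n} F (G : Vector FPS∞ n) →
    (λ e → sum (λ i → G i e)) ⊛∞ F ≋ λ e → sum (λ i → (G i ⊛∞ F) e)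
  ⊛-distribʳ-sum {n} F G e = ≈-trans (⊛-comm _ F e)
    (≈-trans (⊛-distribˡ-sum F G e) (∑-cong n λ i → ⊛-comm F (G i) e))

  ⊛-head : ∀ F G es → (F ⊛∞ G) (0 ∷ es) ≈ ((F ∘ (0 ∷_)) ⊛∞ (G ∘ (0 ∷_))) es
  ⊛-head F G es = +-identityʳ _

  ⊛-identityˡ : ∀ F → 1∞ ⊛∞ F ≋ F
  ⊛-identityˡ F []       = *-identityˡ _
  ⊛-identityˡ F (e ∷ es) = ≈-trans
    (+-cong (⊛-identityˡ _ es) (∑-zero e λ i → ⊛-zeroˡ (F ∘ (e ∸ suc (toℕ i) ∷_)) es))
    (+-identityʳ _)

  -- Associativity is proved by induction on the exponent of y₀: writing
  -- F = F₀ + y₀ F₊, one has (F G)₊ = F₀ G₊ + F₊ G.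
  private
    infixl 7 _⋆_
    _⋆_ : FPS∞ → FPS∞ → FPS∞
    (F ⋆ G) []       = 0#
    (F ⋆ G) (e ∷ es) = (F ⊛∞ (G ∘ (e ∷_))) es

    shift : FPS∞ → FPS∞
    shift F []       = 0#
    shift F (e ∷ es) = F (suc e ∷ es)

    ⊛-cong-∷ : ∀ {F F′ G G′} e es →
      (∀ i es → F (i ∷ es) ≈ F′ (i ∷ es)) → (∀ i es → G (i ∷ es) ≈ G′ (i ∷ es)) →
      (F ⊛∞ G) (e ∷ es) ≈ (F′ ⊛∞ G′) (e ∷ es)
    ⊛-cong-∷ e es p q = ∑-cong (suc e) λ i → ⊛-cong (p (toℕ i)) (q (e ∸ toℕ i)) es

  ⊛-assoc : ∀ F G H → (F ⊛∞ G) ⊛∞ H ≋ F ⊛∞ (G ⊛∞ H)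
  ⊛-assoc F G H []       = *-assoc _ _ _
  ⊛-assoc F G H (e ∷ es) = go F G H e
    where
    ⋆-assoc : ∀ F G H e → ((F ⋆ G) ⊛∞ H) (e ∷ es) ≈ (F ⋆ (G ⊛∞ H)) (e ∷ es)
    ⋆-assoc F G H e = ≈-trans (∑-cong (suc e) λ i → ⊛-assoc F (G ∘ (toℕ i ∷_)) (H ∘ (e ∸ toℕ i ∷_)) es)
      (≈-sym (⊛-distribˡ-sum {suc e} F (λ i → (G ∘ (toℕ i ∷_)) ⊛∞ (H ∘ (e ∸ toℕ i ∷_))) es))

    go : ∀ F G H e → ((F ⊛∞ G) ⊛∞ H) (e ∷ es) ≈ (F ⊛∞ (G ⊛∞ H)) (e ∷ es)
    go F G H zero = begin
      ((F ⊛∞ G) ⊛∞ H) (0 ∷ es)   ≈⟨ ⊛-head (F ⊛∞ G) H es ⟩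
      (((F ⊛∞ G) ∘ (0 ∷_)) ⊛∞ H₀) es  ≈⟨ ⊛-cong (⊛-head F G) (λ _ → ≈-refl) es ⟩
      ((F₀ ⊛∞ G₀) ⊛∞ H₀) es  ≈⟨ ⊛-assoc F₀ G₀ H₀ es ⟩
      (F₀ ⊛∞ (G₀ ⊛∞ H₀)) es  ≈⟨ ⊛-cong {F₀} (λ _ → ≈-refl) (⊛-head G H) es ⟨
      (F₀ ⊛∞ ((G ⊛∞ H) ∘ (0 ∷_))) es  ≈⟨ ⊛-head F (G ⊛∞ H) es ⟨
      (F ⊛∞ (G ⊛∞ H)) (0 ∷ es) ∎
      where
      F₀ = F ∘ (0 ∷_)
      G₀ = G ∘ (0 ∷_)
      H₀ = H ∘ (0 ∷_)
    go F G H (suc e) = begin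
      (((F ⊛∞ G) ∘ (0 ∷_)) ⊛∞ Hₑ) es + (shift (F ⊛∞ G) ⊛∞ H) (e ∷ es)
        ≈⟨ +-cong (⊛-cong (⊛-head F G) (λ _ → ≈-refl) es)
             (⊛-cong-∷ {shift (F ⊛∞ G)} {(F₀ ⋆ shift G) ⊞ (shift F ⊛∞ G)} {H} {H} e es (λ _ _ → ≈-refl) (λ _ _ → ≈-refl)) ⟩
      ((F₀ ⊛∞ G₀) ⊛∞ Hₑ) es + (((F₀ ⋆ shift G) ⊞ (shift F ⊛∞ G)) ⊛∞ H) (e ∷ es)
        ≈⟨ +-cong (⊛-assoc F₀ G₀ Hₑ es) (⊛-distribʳ H (F₀ ⋆ shift G) (shift F ⊛∞ G) (e ∷ es)) ⟩
      (F₀ ⊛∞ (G₀ ⊛∞ Hₑ)) es + (((F₀ ⋆ shift G) ⊛∞ H) (e ∷ es) + ((shift F ⊛∞ G) ⊛∞ H) (e ∷ es))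
        ≈⟨ +-congˡ (+-cong (⋆-assoc F₀ (shift G) H e) (go (shift F) G H e)) ⟩
      (F₀ ⊛∞ (G₀ ⊛∞ Hₑ)) es + ((F₀ ⊛∞ ((shift G ⊛∞ H) ∘ (e ∷_))) es + (shift F ⊛∞ (G ⊛∞ H)) (e ∷ es))
        ≈⟨ +-assoc _ _ _ ⟨
      (F₀ ⊛∞ (G₀ ⊛∞ Hₑ)) es + (F₀ ⊛∞ ((shift G ⊛∞ H) ∘ (e ∷_))) es + (shift F ⊛∞ (G ⊛∞ H)) (e ∷ es)
        ≈⟨ +-congʳ (⊛-distribˡ F₀ _ _ es) ⟨
      (F₀ ⊛∞ ((G ⊛∞ H) ∘ (suc e ∷_))) es + (shift F ⊛∞ (G ⊛∞ H)) (e ∷ es) ∎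
      where
      F₀ = F ∘ (0 ∷_)
      G₀ = G ∘ (0 ∷_)
      Hₑ = H ∘ (suc e ∷_)

  ∑-last : ∀ n (g : ℕ → Carrier) →
    ∑[ i ≤ n ] g (toℕ i) ≈ ∑[ i < n ] g (toℕ i) + g n
  ∑-last zero    g = +-comm _ _
  ∑-last (suc n) g = ≈-trans (+-congˡ (∑-last n (g ∘ suc))) (≈-sym (+-assoc _ _ _))

  ∑-extend : ∀ {m n} (g : ℕ → Carrier) → m ≤ n → (∀ i → m ≤ i → g i ≈ 0#) →
    ∑[ i < m ] g (toℕ i) ≈ ∑[ i < n ] g (toℕ i)
  ∑-extend {n = n} g z≤n     g≈0 = ≈-sym (∑-zero n λ i → g≈0 (toℕ i) z≤n)
  ∑-extend g (s≤s m≤n) g≈0 = +-congˡ (∑-extend (g ∘ suc) m≤n λ i m≤i → g≈0 (suc i) (s≤s m≤i))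

  interchange : ∀ a b c d → (a + b) + (c + d) ≈ (a + c) + (b + d)
  interchange = CommutativeSemigroupProperties.interchange +-commutativeSemigroup

  x∙yz≈y∙xz : ∀ a b c → a * (b * c) ≈ b * (a * c)
  x∙yz≈y∙xz = CommutativeSemigroupProperties.x∙yz≈y∙xz *-commutativeSemigroup

  fromℕ-suc : ∀ n x → fromℕ (suc n) * x ≈ x + fromℕ n * x
  fromℕ-suc n x = ≈-trans (distribʳ x 1# (fromℕ n)) (+-congʳ (*-identityˡ x))

  fromℕ-+ : ∀ m n → fromℕ (m ℕ.+ n) ≈ fromℕ m + fromℕ n
  fromℕ-+ m n = MonoidMult.×-homo-+ +-monoid 1# m n

  infixr 8 _∙_
  _∙_ : Carrier → FPS∞ → FPS∞
  (a ∙ F) e = a * F e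

  ∙-⊛ : ∀ a F G → (a ∙ F) ⊛∞ G ≋ a ∙ (F ⊛∞ G)
  ∙-⊛ a F G []       = *-assoc _ _ _
  ∙-⊛ a F G (e ∷ es) = ≈-trans
    (∑-cong (suc e) λ i → ∙-⊛ a (F ∘ (toℕ i ∷_)) (G ∘ (e ∸ toℕ i ∷_)) es)
    (≈-sym (*-distribˡ-sum {suc e} a λ i → ((F ∘ (toℕ i ∷_)) ⊛∞ (G ∘ (e ∸ toℕ i ∷_))) es))

  ⊛-∙ : ∀ a F G → F ⊛∞ (a ∙ G) ≋ a ∙ (F ⊛∞ G)
  ⊛-∙ a F G e = ≈-trans (⊛-comm F _ e) (≈-trans (∙-⊛ a G F e) (*-congˡ (⊛-comm G F e)))

  ⊟-⊛ : ∀ F G → ⊟ F ⊛∞ G ≋ ⊟ (F ⊛∞ G)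
  ⊟-⊛ F G e = ≈-trans (⊛-cong {⊟ F} {(- 1#) ∙ F} {G} (λ e → ≈-sym (RingProperties.-1*x≈-x ring (F e))) (λ _ → ≈-refl) e)
    (≈-trans (∙-⊛ (- 1#) F G e) (RingProperties.-1*x≈-x ring ((F ⊛∞ G) e)))

  -- Lists of length N stand for the monomials in the first N variables.
  Agree : ℕ → ℕ → FPS∞ → FPS∞ → Set r
  Agree N n F G = ∀ e → length e ≡ N → lsum e < n → F e ≈ G e

  module _ {N n : ℕ} where

    ≋⇒Agree : ∀ {F G} → F ≋ G → Agree N n F G
    ≋⇒Agree p e _ _ = p e

    Agree-refl : ∀ {F} → Agree N n F F
    Agree-refl _ _ _ = ≈-refl

    Agree-sym : ∀ {F G} → Agree N n F G → Agree N n G F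
    Agree-sym p e l s = ≈-sym (p e l s)

    Agree-trans : ∀ {F G H} → Agree N n F G → Agree N n G H → Agree N n F H
    Agree-trans p q e l s = ≈-trans (p e l s) (q e l s)

    Agree-⊞ : ∀ {F F′ G G′} → Agree N n F F′ → Agree N n G G′ → Agree N n (F ⊞ G) (F′ ⊞ G′)
    Agree-⊞ p q e l s = +-cong (p e l s) (q e l s)

    Agree-⊛ : ∀ {F F′ G G′} → Agree N n F F′ → Agree N n G G′ → Agree N n (F ⊛∞ G) (F′ ⊛∞ G′)
    Agree-⊛ p q e l s = ⊛-cong-split e λ e₁ e₂ l₁ l₂ s≡ → *-cong
      (p e₁ (≡.trans l₁ l) (ℕₚ.≤-<-trans (ℕₚ.m+n≤o⇒m≤o _ (ℕₚ.≤-reflexive s≡)) s))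
      (q e₂ (≡.trans l₂ l) (ℕₚ.≤-<-trans (ℕₚ.m+n≤o⇒n≤o (lsum e₁) (ℕₚ.≤-reflexive s≡)) s))

    Agree-^ : ∀ {F G} i → Agree N n F G → Agree N n (F ⊛∞^ i) (G ⊛∞^ i)
    Agree-^ zero    p = Agree-refl {1∞}
    Agree-^ (suc i) p = Agree-⊛ p (Agree-^ i p)

    Agree-⟨⟩ : ∀ f {F G} → Agree N n F G → Agree N n (f ⟨ F ⟩∞) (f ⟨ G ⟩∞)
    Agree-⟨⟩ f p e l s = ∑-cong (suc (lsum e)) λ i → *-congˡ {f (toℕ i)} (Agree-^ (toℕ i) p e l s)

  ZeroConst : ℕ → FPS∞ → Set r
  ZeroConst N F = Agree N 1 F 0∞

  ⊛-step : ∀ {N n F G G′} → ZeroConst N F → Agree N n G G′ → Agree N (suc n) (F ⊛∞ G) (F ⊛∞ G′)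
  ⊛-step {n = n} {F} {G} {G′} F₀ p e l s = ⊛-cong-split e λ e₁ e₂ l₁ l₂ s≡ → go e₁ e₂ (≡.trans l₁ l) (≡.trans l₂ l)
      (ℕₚ.<-≤-trans (≡.subst (_< suc n) (≡.sym s≡) s) ℕₚ.≤-refl) _ ≡.refl
    where
    go : ∀ e₁ e₂ → length e₁ ≡ _ → length e₂ ≡ _ → lsum e₁ ℕ.+ lsum e₂ < suc n →
      ∀ m → lsum e₁ ≡ m → F e₁ * G e₂ ≈ F e₁ * G′ e₂
    go e₁ e₂ l₁ l₂ s zero m≡ = ≈-trans (*-congʳ F≈0) (≈-trans (zeroˡ _) (≈-sym (≈-trans (*-congʳ F≈0) (zeroˡ _))))
      where F≈0 = F₀ e₁ l₁ (s≤s (ℕₚ.≤-reflexive m≡))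
    go e₁ e₂ l₁ l₂ (s≤s s) (suc m) m≡ = *-congˡ (p e₂ l₂
      (ℕₚ.≤-trans (ℕₚ.+-monoˡ-≤ (lsum e₂) (s≤s (z≤n {m}))) (≡.subst (λ k → k ℕ.+ lsum e₂ ≤ n) m≡ s)))

  ^-vanish : ∀ {N F} i → ZeroConst N F → Agree N i (F ⊛∞^ i) 0∞
  ^-vanish zero    F₀ e l ()
  ^-vanish {F = F} (suc i) F₀ = Agree-trans (⊛-step F₀ (^-vanish i F₀))
    (≋⇒Agree λ e → ≈-trans (⊛-comm F 0∞ e) (⊛-zeroˡ F e))

  ⟨⟩-trunc : ∀ {N F} f M e → ZeroConst N F → length e ≡ N → lsum e ≤ M →
    (f ⟨ F ⟩∞) e ≈ ∑[ i ≤ M ] (f (toℕ i) * (F ⊛∞^ toℕ i) e)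
  ⟨⟩-trunc {F = F} f M e F₀ l s = ∑-extend (λ i → f i * (F ⊛∞^ i) e) (s≤s s)
    λ i i> → ≈-trans (*-congˡ (^-vanish i F₀ e l i>)) (zeroʳ _)

  -- Substitution

  tail : FPS → FPS
  tail f n = f (suc n)

  ⟨⟩-cong : ∀ {f g} → (∀ n → f n ≈ g n) → ∀ F → f ⟨ F ⟩∞ ≋ g ⟨ F ⟩∞
  ⟨⟩-cong p F e = ∑-cong (suc (lsum e)) λ i → *-congʳ {(F ⊛∞^ toℕ i) e} (p (toℕ i))

  ⟨⟩-+ : ∀ f g F → (λ n → f n + g n) ⟨ F ⟩∞ ≋ f ⟨ F ⟩∞ ⊞ g ⟨ F ⟩∞
  ⟨⟩-+ f g F e = ≈-trans (∑-cong (suc (lsum e)) λ i → distribʳ ((F ⊛∞^ toℕ i) e) (f (toℕ i)) (g (toℕ i)))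
    (∑-distrib-+ {suc (lsum e)} (λ i → f (toℕ i) * (F ⊛∞^ toℕ i) e) (λ i → g (toℕ i) * (F ⊛∞^ toℕ i) e))

  ⟨⟩-* : ∀ a f F → (λ n → a * f n) ⟨ F ⟩∞ ≋ a ∙ f ⟨ F ⟩∞
  ⟨⟩-* a f F e = ≈-trans (∑-cong (suc (lsum e)) λ i → *-assoc a (f (toℕ i)) ((F ⊛∞^ toℕ i) e))
    (≈-sym (*-distribˡ-sum {suc (lsum e)} a (λ i → f (toℕ i) * (F ⊛∞^ toℕ i) e)))

  module Horner {N F} (F₀ : ZeroConst N F) where

    horner : ∀ f e → length e ≡ N →
      (f ⟨ F ⟩∞) e ≈ f 0 * 1∞ e + (F ⊛∞ tail f ⟨ F ⟩∞) e
    horner f e l = begin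
      (f ⟨ F ⟩∞) e
        ≈⟨ ⟨⟩-trunc f (suc (lsum e)) e F₀ l (ℕₚ.n≤1+n _) ⟩
      f 0 * 1∞ e + ∑[ i ≤ lsum e ] (f (suc (toℕ i)) * (F ⊛∞ F ⊛∞^ toℕ i) e)
        ≈⟨ +-congˡ (∑-cong (suc (lsum e)) λ i → ⊛-∙ (f (suc (toℕ i))) F (F ⊛∞^ toℕ i) e) ⟨
      f 0 * 1∞ e + ∑[ i ≤ lsum e ] (F ⊛∞ (tail f (toℕ i) ∙ F ⊛∞^ toℕ i)) e
        ≈⟨ +-congˡ (⊛-distribˡ-sum {suc (lsum e)} F (λ i → tail f (toℕ i) ∙ F ⊛∞^ toℕ i) e) ⟨
      f 0 * 1∞ e + (F ⊛∞ (λ e′ → ∑[ i ≤ lsum e ] (tail f (toℕ i) * (F ⊛∞^ toℕ i) e′))) e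
        ≈⟨ +-congˡ (⊛-cong-split {F} {F} e λ e₁ e₂ l₁ l₂ s≡ → *-congˡ
             (⟨⟩-trunc (tail f) (lsum e) e₂ F₀ (≡.trans l₂ l)
               (ℕₚ.m+n≤o⇒n≤o (lsum e₁) (ℕₚ.≤-reflexive s≡)))) ⟨
      f 0 * 1∞ e + (F ⊛∞ tail f ⟨ F ⟩∞) e ∎

    ⟨⟩-⊛ : ∀ n f g → Agree N n ((f ⊛ g) ⟨ F ⟩∞) (f ⟨ F ⟩∞ ⊛∞ g ⟨ F ⟩∞)
    ⟨⟩-⊛ zero    f g e l ()
    ⟨⟩-⊛ (suc n) f g e l s = begin
      ((f ⊛ g) ⟨ F ⟩∞) e
        ≈⟨ horner (f ⊛ g) e l ⟩
      (f ⊛ g) 0 * 1∞ e + (F ⊛∞ tail (f ⊛ g) ⟨ F ⟩∞) e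
        ≈⟨ +-cong (≈-trans (*-congʳ (+-identityʳ _)) (*-assoc _ _ _))
             (⊛-cong {F} {F} (λ _ → ≈-refl)
               (λ e′ → ≈-trans (⟨⟩-+ (λ n → f 0 * g (suc n)) (tail f ⊛ g) F e′)
                 (+-congʳ (⟨⟩-* (f 0) (tail g) F e′))) e) ⟩
      f 0 * (g 0 * 1∞ e) + (F ⊛∞ (f 0 ∙ tail g ⟨ F ⟩∞ ⊞ (tail f ⊛ g) ⟨ F ⟩∞)) e
        ≈⟨ +-congˡ (⊛-step F₀ (Agree-⊞ Agree-refl (⟨⟩-⊛ n (tail f) g)) e l s) ⟩
      f 0 * (g 0 * 1∞ e) + (F ⊛∞ (f 0 ∙ tail g ⟨ F ⟩∞ ⊞ tail f ⟨ F ⟩∞ ⊛∞ g ⟨ F ⟩∞)) e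
        ≈⟨ +-congˡ (⊛-distribˡ F _ _ e) ⟩
      f 0 * (g 0 * 1∞ e) + ((F ⊛∞ (f 0 ∙ tail g ⟨ F ⟩∞)) e + (F ⊛∞ (tail f ⟨ F ⟩∞ ⊛∞ g ⟨ F ⟩∞)) e)
        ≈⟨ +-assoc _ _ _ ⟨
      f 0 * (g 0 * 1∞ e) + (F ⊛∞ (f 0 ∙ tail g ⟨ F ⟩∞)) e + (F ⊛∞ (tail f ⟨ F ⟩∞ ⊛∞ g ⟨ F ⟩∞)) e
        ≈⟨ +-cong (+-congˡ (⊛-∙ (f 0) F _ e)) (≈-sym (⊛-assoc F _ _ e)) ⟩
      f 0 * (g 0 * 1∞ e) + f 0 * (F ⊛∞ tail g ⟨ F ⟩∞) e + ((F ⊛∞ tail f ⟨ F ⟩∞) ⊛∞ g ⟨ F ⟩∞) e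
        ≈⟨ +-congʳ (distribˡ (f 0) _ _) ⟨
      f 0 * (g 0 * 1∞ e + (F ⊛∞ tail g ⟨ F ⟩∞) e) + ((F ⊛∞ tail f ⟨ F ⟩∞) ⊛∞ g ⟨ F ⟩∞) e
        ≈⟨ +-congʳ (*-congˡ (horner g e l)) ⟨
      f 0 * (g ⟨ F ⟩∞) e + ((F ⊛∞ tail f ⟨ F ⟩∞) ⊛∞ g ⟨ F ⟩∞) e
        ≈⟨ +-congʳ (≈-trans (∙-⊛ (f 0) 1∞ _ e) (*-congˡ (⊛-identityˡ _ e))) ⟨
      ((f 0 ∙ 1∞) ⊛∞ g ⟨ F ⟩∞) e + ((F ⊛∞ tail f ⟨ F ⟩∞) ⊛∞ g ⟨ F ⟩∞) e
        ≈⟨ ⊛-distribʳ (g ⟨ F ⟩∞) (f 0 ∙ 1∞) (F ⊛∞ tail f ⟨ F ⟩∞) e ⟨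
      ((f 0 ∙ 1∞ ⊞ F ⊛∞ tail f ⟨ F ⟩∞) ⊛∞ g ⟨ F ⟩∞) e
        ≈⟨ Agree-⊛ {N} {suc n} (λ e l _ → horner f e l) Agree-refl e l s ⟨
      (f ⟨ F ⟩∞ ⊛∞ g ⟨ F ⟩∞) e ∎

  -- Derivatives

  length-raise : ∀ j e → j < length e → length (raise j e) ≡ length e
  length-raise zero    (_ ∷ es) _         = ≡.refl
  length-raise (suc j) (_ ∷ es) (s≤s j<l) = ≡.cong suc (length-raise j es j<l)

  sum-raise : ∀ j e → lsum (raise j e) ≡ suc (lsum e)
  sum-raise zero    []       = ≡.refl
  sum-raise zero    (_ ∷ es) = ≡.refl
  sum-raise (suc j) []       = sum-raise j []
  sum-raise (suc j) (e ∷ es) = ≡.trans (≡.cong (e ℕ.+_) (sum-raise j es)) (ℕₚ.+-suc e _)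

  ∂-Agree : ∀ {N n j F G} → j < N → Agree N (suc n) F G → Agree N n (∂ j F) (∂ j G)
  ∂-Agree {j = j} j<N p e ≡.refl s =
    *-congˡ (p (raise j e) (length-raise j e j<N) (s≤s (≡.subst (_≤ _) (≡.sym (sum-raise j e)) s)))

  ∂-⊞ : ∀ j F G → ∂ j (F ⊞ G) ≋ ∂ j F ⊞ ∂ j G
  ∂-⊞ j F G e = distribˡ _ _ _

  ∂-∙ : ∀ j a F → ∂ j (a ∙ F) ≋ a ∙ ∂ j F
  ∂-∙ j a F e = x∙yz≈y∙xz _ _ _

  ∂-1 : ∀ j e → j < length e → ∂ j 1∞ e ≈ 0#
  ∂-1 zero    (_ ∷ es)     j<l       = zeroʳ _
  ∂-1 (suc j) (zero ∷ es)  (s≤s j<l) = ∂-1 j es j<l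
  ∂-1 (suc j) (suc _ ∷ es) j<l       = zeroʳ _

  ∑-Euler : ∀ n (a : ℕ → Carrier) →
    fromℕ (suc n) * ∑[ i ≤ suc n ] a (toℕ i) ≈
      ∑[ i ≤ n ] (fromℕ (suc (toℕ i)) * a (suc (toℕ i))) +
      ∑[ i ≤ n ] (fromℕ (suc (n ∸ toℕ i)) * a (toℕ i))
  ∑-Euler n a = begin
    fromℕ (suc n) * ∑[ i ≤ suc n ] a (toℕ i)
      ≈⟨ *-distribˡ-sum {suc (suc n)} (fromℕ (suc n)) (λ i → a (toℕ i)) ⟩
    ∑[ i ≤ suc n ] (fromℕ (suc n) * a (toℕ i))
      ≈⟨ ∑-cong (suc (suc n)) (λ i → ≈-trans (*-congʳ {a (toℕ i)}
           (≈-trans (reflexive (≡.cong fromℕ (≡.sym (ℕₚ.m+[n∸m]≡n (Finₚ.toℕ≤pred[n] i)))))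
             (fromℕ-+ (toℕ i) (suc n ∸ toℕ i))))
           (distribʳ (a (toℕ i)) (fromℕ (toℕ i)) (fromℕ (suc n ∸ toℕ i)))) ⟩
    ∑[ i ≤ suc n ] (fromℕ (toℕ i) * a (toℕ i) + fromℕ (suc n ∸ toℕ i) * a (toℕ i))
      ≈⟨ ∑-distrib-+ {suc (suc n)} (λ i → fromℕ (toℕ i) * a (toℕ i)) (λ i → fromℕ (suc n ∸ toℕ i) * a (toℕ i)) ⟩
    ∑[ i ≤ suc n ] (fromℕ (toℕ i) * a (toℕ i)) + ∑[ i ≤ suc n ] (fromℕ (suc n ∸ toℕ i) * a (toℕ i))
      ≈⟨ +-cong (≈-trans (+-congʳ (zeroˡ _)) (+-identityˡ _))
           (≈-trans (∑-last (suc n) (λ i → fromℕ (suc n ∸ i) * a i))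
             (≈-trans (+-congˡ (≈-trans (*-congʳ (reflexive (≡.cong fromℕ (ℕₚ.n∸n≡0 n)))) (zeroˡ _))) (+-identityʳ _))) ⟩
    ∑[ i ≤ n ] (fromℕ (suc (toℕ i)) * a (suc (toℕ i))) + ∑[ i ≤ n ] (fromℕ (suc n ∸ toℕ i) * a (toℕ i))
      ≈⟨ +-congˡ (∑-cong (suc n) λ i → *-congʳ {a (toℕ i)} (reflexive (≡.cong fromℕ (ℕₚ.+-∸-assoc 1 (Finₚ.toℕ≤pred[n] i))))) ⟩
    ∑[ i ≤ n ] (fromℕ (suc (toℕ i)) * a (suc (toℕ i))) +
      ∑[ i ≤ n ] (fromℕ (suc (n ∸ toℕ i)) * a (toℕ i)) ∎

  ∂-⊛ : ∀ j F G e → j < length e → ∂ j (F ⊛∞ G) e ≈ (∂ j F ⊛∞ G ⊞ F ⊛∞ ∂ j G) e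
  ∂-⊛ zero F G (e ∷ es) _ = begin
    fromℕ (suc e) * ∑[ i ≤ suc e ] a (toℕ i)
      ≈⟨ ∑-Euler e a ⟩
    ∑[ i ≤ e ] (fromℕ (suc (toℕ i)) * a (suc (toℕ i))) + ∑[ i ≤ e ] (fromℕ (suc (e ∸ toℕ i)) * a (toℕ i))
      ≈⟨ +-cong
           (∑-cong (suc e) λ i → ≈-sym (∙-⊛ (fromℕ (suc (toℕ i))) (F ∘ (suc (toℕ i) ∷_)) (G ∘ (e ∸ toℕ i ∷_)) es))
           (∑-cong (suc e) λ i → ≈-trans
             (*-congˡ {fromℕ (suc (e ∸ toℕ i))} (reflexive (≡.cong (λ m → ((F ∘ (toℕ i ∷_)) ⊛∞ (G ∘ (m ∷_))) es)
               (ℕₚ.+-∸-assoc 1 (Finₚ.toℕ≤pred[n] i)))))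
             (≈-sym (⊛-∙ (fromℕ (suc (e ∸ toℕ i))) (F ∘ (toℕ i ∷_)) (G ∘ (suc (e ∸ toℕ i) ∷_)) es))) ⟩
    (∂ zero F ⊛∞ G ⊞ F ⊛∞ ∂ zero G) (e ∷ es) ∎
    where
    a : ℕ → Carrier
    a i = ((F ∘ (i ∷_)) ⊛∞ (G ∘ (suc e ∸ i ∷_))) es
  ∂-⊛ (suc j) F G (e ∷ es) (s≤s j<l) = begin
    m * ∑[ i ≤ e ] ((Fᵢ i ⊛∞ Gᵢ i) (raise j es))
      ≈⟨ *-distribˡ-sum {suc e} m (λ i → (Fᵢ i ⊛∞ Gᵢ i) (raise j es)) ⟩
    ∑[ i ≤ e ] (∂ j (Fᵢ i ⊛∞ Gᵢ i) es)
      ≈⟨ ∑-cong (suc e) (λ i → ∂-⊛ j (Fᵢ i) (Gᵢ i) es j<l) ⟩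
    ∑[ i ≤ e ] ((∂ j (Fᵢ i) ⊛∞ Gᵢ i) es + (Fᵢ i ⊛∞ ∂ j (Gᵢ i)) es)
      ≈⟨ ∑-distrib-+ {suc e} (λ i → (∂ j (Fᵢ i) ⊛∞ Gᵢ i) es) (λ i → (Fᵢ i ⊛∞ ∂ j (Gᵢ i)) es) ⟩
    (∂ (suc j) F ⊛∞ G ⊞ F ⊛∞ ∂ (suc j) G) (e ∷ es) ∎
    where
    m = fromℕ (suc (exponent j es))
    Fᵢ Gᵢ : Fin (suc e) → FPS∞
    Fᵢ i = F ∘ (toℕ i ∷_)
    Gᵢ i = G ∘ (e ∸ toℕ i ∷_)

  ∂-comm : ∀ j F e → 0 < length e → ∂ (suc j) (∂ 0 F) e ≈ ∂ 0 (∂ (suc j) F) e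
  ∂-comm j F (e ∷ es) _ = x∙yz≈y∙xz _ _ _

  deriv-tail : ∀ f n → tail (deriv f) n ≈ tail (tail f) n + deriv (tail f) n
  deriv-tail f n = fromℕ-suc (suc n) (f (suc (suc n)))

  chain-rule : ∀ {N j F} → j < N → ZeroConst N F → ∀ n f →
    Agree N n (∂ j (f ⟨ F ⟩∞)) (deriv f ⟨ F ⟩∞ ⊛∞ ∂ j F)
  chain-rule j<N F₀ zero    f e l ()
  chain-rule {N} {j} {F} j<N F₀ (suc n) f e ≡.refl s = begin
    ∂ j (f ⟨ F ⟩∞) e
      ≈⟨ ∂-Agree {N} {suc n} {j} j<N (λ e l _ → horner f e l) e ≡.refl s ⟩
    ∂ j (f 0 ∙ 1∞ ⊞ F ⊛∞ tail f ⟨ F ⟩∞) e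
      ≈⟨ ∂-⊞ j (f 0 ∙ 1∞) (F ⊛∞ tail f ⟨ F ⟩∞) e ⟩
    ∂ j (f 0 ∙ 1∞) e + ∂ j (F ⊛∞ tail f ⟨ F ⟩∞) e
      ≈⟨ +-cong (≈-trans (∂-∙ j (f 0) 1∞ e) (≈-trans (*-congˡ (∂-1 j e j<N)) (zeroʳ _)))
           (∂-⊛ j F (tail f ⟨ F ⟩∞) e j<N) ⟩
    0# + ((∂ j F ⊛∞ tail f ⟨ F ⟩∞) e + (F ⊛∞ ∂ j (tail f ⟨ F ⟩∞)) e)
      ≈⟨ +-identityˡ _ ⟩
    (∂ j F ⊛∞ tail f ⟨ F ⟩∞) e + (F ⊛∞ ∂ j (tail f ⟨ F ⟩∞)) e
      ≈⟨ +-cong (⊛-comm (∂ j F) _ e) (⊛-step F₀ (chain-rule j<N F₀ n (tail f)) e ≡.refl s) ⟩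
    (tail f ⟨ F ⟩∞ ⊛∞ ∂ j F) e + (F ⊛∞ (deriv (tail f) ⟨ F ⟩∞ ⊛∞ ∂ j F)) e
      ≈⟨ +-congˡ (⊛-assoc F _ _ e) ⟨
    (tail f ⟨ F ⟩∞ ⊛∞ ∂ j F) e + ((F ⊛∞ deriv (tail f) ⟨ F ⟩∞) ⊛∞ ∂ j F) e
      ≈⟨ ⊛-distribʳ (∂ j F) (tail f ⟨ F ⟩∞) (F ⊛∞ deriv (tail f) ⟨ F ⟩∞) e ⟨
    ((tail f ⟨ F ⟩∞ ⊞ F ⊛∞ deriv (tail f) ⟨ F ⟩∞) ⊛∞ ∂ j F) e
      ≈⟨ Agree-⊛ {N} {suc n} (λ e l _ → factor e l) Agree-refl e ≡.refl s ⟩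
    (deriv f ⟨ F ⟩∞ ⊛∞ ∂ j F) e ∎
    where
    open Horner F₀
    factor : ∀ e → length e ≡ N → (tail f ⟨ F ⟩∞ ⊞ F ⊛∞ deriv (tail f) ⟨ F ⟩∞) e ≈ (deriv f ⟨ F ⟩∞) e
    factor e l = begin
      (tail f ⟨ F ⟩∞) e + (F ⊛∞ deriv (tail f) ⟨ F ⟩∞) e
        ≈⟨ +-congʳ (horner (tail f) e l) ⟩
      f 1 * 1∞ e + (F ⊛∞ tail (tail f) ⟨ F ⟩∞) e + (F ⊛∞ deriv (tail f) ⟨ F ⟩∞) e
        ≈⟨ +-assoc _ _ _ ⟩
      f 1 * 1∞ e + ((F ⊛∞ tail (tail f) ⟨ F ⟩∞) e + (F ⊛∞ deriv (tail f) ⟨ F ⟩∞) e)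
        ≈⟨ +-cong (*-congʳ (≈-trans (*-congʳ (+-identityʳ 1#)) (*-identityˡ _))) (⊛-distribˡ F _ _ e) ⟨
      deriv f 0 * 1∞ e + (F ⊛∞ (tail (tail f) ⟨ F ⟩∞ ⊞ deriv (tail f) ⟨ F ⟩∞)) e
        ≈⟨ +-congˡ (⊛-cong {F} {F} (λ _ → ≈-refl) (λ e → ≈-trans (⟨⟩-cong (deriv-tail f) F e)
             (⟨⟩-+ (tail (tail f)) (deriv (tail f)) F e)) e) ⟨
      deriv f 0 * 1∞ e + (F ⊛∞ tail (deriv f) ⟨ F ⟩∞) e
        ≈⟨ horner (deriv f) e l ⟨
      (deriv f ⟨ F ⟩∞) e ∎

  -- Implicit equations

  y-cong : ∀ j e {F G} →
    (∀ e′ → length e′ ≡ length e → suc (lsum e′) ≡ lsum e → F e′ ≈ G e′) →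
    (y[ j ]· F) e ≈ (y[ j ]· G) e
  y-cong j       []           p = ≈-refl
  y-cong zero    (zero  ∷ es) p = ≈-refl
  y-cong zero    (suc e ∷ es) p = p (e ∷ es) ≡.refl ≡.refl
  y-cong (suc j) (e ∷ es)     p = y-cong j es λ e′ l s →
    p (e ∷ e′) (≡.cong suc l) (≡.trans (≡.sym (ℕₚ.+-suc e _)) (≡.cong (e ℕ.+_) s))

  y-∙ : ∀ j a F → y[ j ]· (a ∙ F) ≋ a ∙ (y[ j ]· F)
  y-∙ j       a F []           = ≈-sym (zeroʳ a)
  y-∙ zero    a F (zero  ∷ es) = ≈-sym (zeroʳ a)
  y-∙ zero    a F (suc e ∷ es) = ≈-refl
  y-∙ (suc j) a F (e ∷ es)     = y-∙ j a (F ∘ (e ∷_)) es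

  y-0 : ∀ j → y[ j ]· 0∞ ≋ 0∞
  y-0 j       []           = ≈-refl
  y-0 zero    (zero  ∷ es) = ≈-refl
  y-0 zero    (suc e ∷ es) = ≈-refl
  y-0 (suc j) (e ∷ es)     = y-0 j es

  y-sum : ∀ {n} j (F : Vector FPS∞ n) →
    y[ j ]· (λ e → sum (λ i → F i e)) ≋ λ e → sum (λ i → (y[ j ]· F i) e)
  y-sum {n} j       F []           = ≈-sym (∑-zero n λ _ → ≈-refl)
  y-sum {n} zero    F (zero  ∷ es) = ≈-sym (∑-zero n λ _ → ≈-refl)
  y-sum     zero    F (suc e ∷ es) = ≈-refl
  y-sum     (suc j) F (e ∷ es)     = y-sum j (λ i → F i ∘ (e ∷_)) es

  y-⊛ : ∀ j F G → (y[ j ]· F) ⊛∞ G ≋ y[ j ]· (F ⊛∞ G)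
  y-⊛ j       F G []           = zeroˡ _
  y-⊛ zero    F G (zero  ∷ es) = ≈-trans (+-identityʳ _) (⊛-zeroˡ (G ∘ (0 ∷_)) es)
  y-⊛ zero    F G (suc e ∷ es) = ≈-trans (+-congʳ (⊛-zeroˡ (G ∘ (suc e ∷_)) es)) (+-identityˡ _)
  y-⊛ (suc j) F G (e ∷ es)     = ≈-trans
    (∑-cong (suc e) λ i → y-⊛ j (F ∘ (toℕ i ∷_)) (G ∘ (e ∸ toℕ i ∷_)) es)
    (≈-sym (y-sum {suc e} j (λ i → (F ∘ (toℕ i ∷_)) ⊛∞ (G ∘ (e ∸ toℕ i ∷_))) es))

  Σy-∙ : ∀ a G → Σy (λ j → a ∙ G j) ≋ a ∙ Σy G
  Σy-∙ a G e = ≈-trans (∑-cong (length e) λ j → y-∙ (toℕ j) a (G (toℕ j)) e)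
    (≈-sym (*-distribˡ-sum {length e} a (λ j → (y[ toℕ j ]· G (toℕ j)) e)))

  Σy-⊛ : ∀ G F → Σy G ⊛∞ F ≋ Σy (λ j → G j ⊛∞ F)
  Σy-⊛ G F e = begin
    (Σy G ⊛∞ F) e
      ≈⟨ ⊛-cong-split e (λ e₁ e₂ l₁ _ _ → *-congʳ
           (reflexive (≡.cong (λ n → ∑[ j < n ] ((y[ toℕ j ]· G (toℕ j)) e₁)) l₁))) ⟩
    ((λ e₁ → ∑[ j < length e ] ((y[ toℕ j ]· G (toℕ j)) e₁)) ⊛∞ F) e
      ≈⟨ ⊛-distribʳ-sum {length e} F (λ j → y[ toℕ j ]· G (toℕ j)) e ⟩
    ∑[ j < length e ] (((y[ toℕ j ]· G (toℕ j)) ⊛∞ F) e)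
      ≈⟨ ∑-cong (length e) (λ j → y-⊛ (toℕ j) (G (toℕ j)) F e) ⟩
    Σy (λ j → G j ⊛∞ F) e ∎

  Σy-step : ∀ {N n} {F G : ℕ → FPS∞} → (∀ j → Agree N n (F j) (G j)) → Agree N (suc n) (Σy F) (Σy G)
  Σy-step p e l s = ∑-cong (length e) λ j → y-cong (toℕ j) e λ e′ l′ s′ →
    p (toℕ j) e′ (≡.trans l′ l) (≡.subst (_≤ _) (≡.sym s′) (ℕₚ.≤-pred s))

  Σy-cong : ∀ {F G : ℕ → FPS∞} → (∀ j → F j ≋ G j) → Σy F ≋ Σy G
  Σy-cong p e = ∑-cong (length e) λ j → y-cong (toℕ j) e λ e′ _ _ → p (toℕ j) e′

  ∂-Σy : ∀ j G e → j < length e → ∂ j (Σy G) e ≈ G j e + Σy (λ i → ∂ j (G i)) e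
  ∂-Σy zero G (e ∷ es) _ = begin
    fromℕ (suc e) * (G 0 (e ∷ es) + Σy (λ i → G (suc i) ∘ (suc e ∷_)) es)
      ≈⟨ distribˡ _ _ _ ⟩
    fromℕ (suc e) * G 0 (e ∷ es) + fromℕ (suc e) * Σy (λ i → G (suc i) ∘ (suc e ∷_)) es
      ≈⟨ +-cong (fromℕ-suc e _) (≈-sym (Σy-∙ (fromℕ (suc e)) (λ i → G (suc i) ∘ (suc e ∷_)) es)) ⟩
    G 0 (e ∷ es) + fromℕ e * G 0 (e ∷ es) + Σy (λ i → ∂ 0 (G (suc i)) ∘ (e ∷_)) es
      ≈⟨ +-assoc _ _ _ ⟩
    G 0 (e ∷ es) + (fromℕ e * G 0 (e ∷ es) + Σy (λ i → ∂ 0 (G (suc i)) ∘ (e ∷_)) es)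
      ≈⟨ +-congˡ (+-congʳ (head e)) ⟩
    G 0 (e ∷ es) + Σy (λ i → ∂ zero (G i)) (e ∷ es) ∎
    where
    head : ∀ e → fromℕ e * G 0 (e ∷ es) ≈ (y[ 0 ]· ∂ 0 (G 0)) (e ∷ es)
    head zero    = zeroˡ _
    head (suc e) = ≈-refl
  ∂-Σy (suc j) G (e ∷ es) (s≤s j<l) = begin
    m * ((y[ 0 ]· G 0) (e ∷ raise j es) + Σy (λ i → G (suc i) ∘ (e ∷_)) (raise j es))
      ≈⟨ distribˡ _ _ _ ⟩
    m * (y[ 0 ]· G 0) (e ∷ raise j es) + ∂ j (Σy (λ i → G (suc i) ∘ (e ∷_))) es
      ≈⟨ +-cong (head e) (∂-Σy j (λ i → G (suc i) ∘ (e ∷_)) es j<l) ⟩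
    h + (G (suc j) (e ∷ es) + t)
      ≈⟨ CommutativeSemigroupProperties.x∙yz≈y∙xz +-commutativeSemigroup h _ t ⟩
    G (suc j) (e ∷ es) + (h + t) ∎
    where
    m = fromℕ (suc (exponent j es))
    h = (y[ 0 ]· ∂ (suc j) (G 0)) (e ∷ es)
    t = Σy (λ i → ∂ j (G (suc i) ∘ (e ∷_))) es
    head : ∀ e → m * (y[ 0 ]· G 0) (e ∷ raise j es) ≈ (y[ 0 ]· ∂ (suc j) (G 0)) (e ∷ es)
    head zero    = zeroʳ _
    head (suc e) = ≈-refl

  -- For Ψ = r + ⋯ the equation Ψ(F) = Σⱼ yⱼ φⱼ(F) says that F is a fixed
  -- point of F ↦ Σⱼ yⱼ φⱼ(F) - (Ψ(F) - F), which raises the degree up to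
  -- which two series agree.
  module FixedPoint (Ψ : FPS) (Ψ₀ : Ψ 0 ≈ 0#) (Ψ₁ : Ψ 1 ≈ 1#) (φ : ℕ → FPS) where

    higher : FPS∞ → FPS∞
    higher F = F ⊛∞ (F ⊛∞ tail (tail Ψ) ⟨ F ⟩∞)

    rhs : FPS∞ → FPS∞
    rhs F = Σy (λ j → φ j ⟨ F ⟩∞)

    step : FPS∞ → FPS∞
    step F = rhs F ⊞ ⊟ higher F

    Solves : ℕ → FPS∞ → Set r
    Solves N F = ∀ e → length e ≡ N → (Ψ ⟨ F ⟩∞) e ≈ rhs F e

    module _ {N : ℕ} where

      Ψ-split : ∀ {F} → ZeroConst N F → ∀ e → length e ≡ N → (Ψ ⟨ F ⟩∞) e ≈ F e + higher F e
      Ψ-split {F} F₀ e l = begin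
        (Ψ ⟨ F ⟩∞) e
          ≈⟨ horner Ψ e l ⟩
        Ψ 0 * 1∞ e + (F ⊛∞ tail Ψ ⟨ F ⟩∞) e
          ≈⟨ +-cong (≈-trans (*-congʳ Ψ₀) (zeroˡ _))
               (Agree-⊛ {N} {suc (lsum e)} {F} Agree-refl (λ e l _ → inner e l) e l ℕₚ.≤-refl) ⟩
        0# + (F ⊛∞ (1∞ ⊞ (F ⊛∞ tail (tail Ψ) ⟨ F ⟩∞))) e
          ≈⟨ ≈-trans (+-identityˡ _) (⊛-distribˡ F _ _ e) ⟩
        (F ⊛∞ 1∞) e + higher F e
          ≈⟨ +-congʳ (≈-trans (⊛-comm F 1∞ e) (⊛-identityˡ F e)) ⟩
        F e + higher F e ∎
        where
        open Horner F₀
        inner : ∀ e → length e ≡ N → (tail Ψ ⟨ F ⟩∞) e ≈ 1∞ e + (F ⊛∞ tail (tail Ψ) ⟨ F ⟩∞) e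
        inner e l = ≈-trans (horner (tail Ψ) e l) (+-congʳ (≈-trans (*-congʳ Ψ₁) (*-identityˡ _)))

      ⊛-ZeroConst : ∀ {F} G → ZeroConst N F → ZeroConst N (F ⊛∞ G)
      ⊛-ZeroConst {F} G F₀ = Agree-trans (Agree-⊛ F₀ Agree-refl) (≋⇒Agree (⊛-zeroˡ G))

      higher-step : ∀ {n F G} → ZeroConst N F → ZeroConst N G → Agree N n F G →
        Agree N (suc n) (higher F) (higher G)
      higher-step {n} {F} {G} F₀ G₀ p = Agree-trans
        (⊛-step F₀ (Agree-⊛ p (Agree-⟨⟩ (tail (tail Ψ)) p)))
        (Agree-trans (≋⇒Agree (⊛-comm F X))
          (Agree-trans (⊛-step (⊛-ZeroConst (tail (tail Ψ) ⟨ G ⟩∞) G₀) p) (≋⇒Agree (⊛-comm X G))))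
        where X = G ⊛∞ tail (tail Ψ) ⟨ G ⟩∞

      step-step : ∀ {n F G} → ZeroConst N F → ZeroConst N G → Agree N n F G →
        Agree N (suc n) (step F) (step G)
      step-step F₀ G₀ p e l s = +-cong (Σy-step (λ j → Agree-⟨⟩ (φ j) p) e l s)
        (-‿cong (higher-step F₀ G₀ p e l s))

      step-ZeroConst : ∀ {F} → ZeroConst N F → ZeroConst N (step F)
      step-ZeroConst {F} F₀ e l s = begin
        rhs F e + - higher F e
          ≈⟨ +-cong
               (≈-trans (Σy-step {F = λ j → φ j ⟨ F ⟩∞} {λ _ → 0∞} (λ j e l ()) e l s)
                 (∑-zero (length e) λ j → y-0 (toℕ j) e))
               (-‿cong (⊛-ZeroConst _ F₀ e l s)) ⟩
        0# + - 0#
          ≈⟨ -‿inverseʳ 0# ⟩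
        0# ∎

      fixed⇒solves : ∀ {F} → ZeroConst N F → (∀ e → length e ≡ N → F e ≈ step F e) → Solves N F
      fixed⇒solves {F} F₀ p e l = begin
        (Ψ ⟨ F ⟩∞) e                        ≈⟨ Ψ-split F₀ e l ⟩
        F e + higher F e                    ≈⟨ +-congʳ (p e l) ⟩
        rhs F e + - higher F e + higher F e ≈⟨ +-assoc _ _ _ ⟩
        rhs F e + (- higher F e + higher F e) ≈⟨ +-congˡ (-‿inverseˡ _) ⟩
        rhs F e + 0#                        ≈⟨ +-identityʳ _ ⟩
        rhs F e ∎

      solves⇒fixed : ∀ {F} → ZeroConst N F → Solves N F → ∀ e → length e ≡ N → F e ≈ step F e
      solves⇒fixed {F} F₀ p e l = begin
        F e                                 ≈⟨ +-identityʳ _ ⟨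
        F e + 0#                            ≈⟨ +-congˡ (-‿inverseʳ _) ⟨
        F e + (higher F e + - higher F e)   ≈⟨ +-assoc _ _ _ ⟨
        F e + higher F e + - higher F e     ≈⟨ +-congʳ (≈-trans (≈-sym (Ψ-split F₀ e l)) (p e l)) ⟩
        step F e ∎

      unique : ∀ {F G} → ZeroConst N F → ZeroConst N G → Solves N F → Solves N G →
        ∀ n → Agree N n F G
      unique F₀ G₀ p q zero    e l ()
      unique F₀ G₀ p q (suc n) e l s = ≈-trans (solves⇒fixed F₀ p e l)
        (≈-trans (step-step F₀ G₀ (unique F₀ G₀ p q n) e l s) (≈-sym (solves⇒fixed G₀ q e l)))

    iter : ℕ → FPS∞
    iter zero    = 0∞
    iter (suc n) = step (iter n)

    solution : FPS∞
    solution e = iter (suc (lsum e)) e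

    module _ {N : ℕ} where

      iter-ZeroConst : ∀ n → ZeroConst N (iter n)
      iter-ZeroConst zero    = Agree-refl
      iter-ZeroConst (suc n) = step-ZeroConst (iter-ZeroConst n)

      iter-suc : ∀ n → Agree N n (iter n) (iter (suc n))
      iter-suc zero    e l ()
      iter-suc (suc n) = step-step (iter-ZeroConst n) (iter-ZeroConst (suc n)) (iter-suc n)

      iter-≤ : ∀ {m n} → m ℕ.≤′ n → Agree N m (iter m) (iter n)
      iter-≤ ℕ.≤′-refl       = Agree-refl
      iter-≤ (ℕ.≤′-step {n} m≤n) e l s = ≈-trans (iter-≤ m≤n e l s)
        (iter-suc n e l (ℕₚ.<-≤-trans s (ℕₚ.≤′⇒≤ m≤n)))

      solution-iter : ∀ n → Agree N n solution (iter n)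
      solution-iter n e l s = iter-≤ (ℕₚ.≤⇒≤′ s) e l ℕₚ.≤-refl

      solution-ZeroConst : ZeroConst N solution
      solution-ZeroConst = Agree-trans (solution-iter 1) (iter-ZeroConst 1)

      solution-fixed : ∀ e → length e ≡ N → solution e ≈ step solution e
      solution-fixed e l = step-step (iter-ZeroConst (lsum e)) solution-ZeroConst
        (Agree-sym (solution-iter (lsum e))) e l ℕₚ.≤-refl

      solution-solves : Solves N solution
      solution-solves = fixed⇒solves solution-ZeroConst solution-fixed

  -- Power series in one variable

  lift : FPS → FPS∞
  lift f []      = 0#
  lift f (n ∷ _) = f n

  infix 4 _≋ₛ_
  _≋ₛ_ : FPS → FPS → Set r
  f ≋ₛ g = ∀ n → f n ≈ g n

  ⊛ₛ-cong : ∀ {f f′ g g′} → f ≋ₛ f′ → g ≋ₛ g′ → f ⊛ g ≋ₛ f′ ⊛ g′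
  ⊛ₛ-cong p q n = ∑-cong (suc n) λ i → *-cong (p (toℕ i)) (q (n ∸ toℕ i))

  FPS-ring : CommutativeRing c r
  FPS-ring = record
    { Carrier = FPS
    ; _≈_ = _≋ₛ_
    ; _+_ = AbelianGroup._∙_ additive
    ; _*_ = _⊛_
    ; -_ = AbelianGroup._⁻¹ additive
    ; 0# = AbelianGroup.ε additive
    ; 1# = 1ₛ
    ; isCommutativeRing = record
      { isRing = record
        { +-isAbelianGroup = AbelianGroup.isAbelianGroup additive
        ; *-cong = ⊛ₛ-cong
        ; *-assoc = λ f g h n → ⊛-assoc (lift f) (lift g) (lift h) (n ∷ [])
        ; *-identity = identityˡ
          , λ f n → ≈-trans (comm f 1ₛ n) (identityˡ f n)
        ; distrib = (λ f g h n → ⊛-distribˡ (lift f) (lift g) (lift h) (n ∷ []))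
          , λ f g h n → ⊛-distribʳ (lift f) (lift g) (lift h) (n ∷ [])
        }
      ; *-comm = comm
      }
    }
    where
    additive = Pointwise.abelianGroup ℕ +-abelianGroup
    comm : ∀ f g → f ⊛ g ≋ₛ g ⊛ f
    comm f g n = ⊛-comm (lift f) (lift g) (n ∷ [])
    identityˡ : ∀ f → 1ₛ ⊛ f ≋ₛ f
    identityˡ f n = ≈-trans
      (+-cong (*-identityˡ (f n)) (∑-zero n λ i → zeroˡ (f (n ∸ suc (toℕ i)))))
      (+-identityʳ (f n))

  ∏ₛ-cong : ∀ {k} {F G : Vector FPS k} → (∀ i → F i ≋ₛ G i) → ∏ₛ F ≋ₛ ∏ₛ G
  ∏ₛ-cong {zero}  p = λ _ → ≈-refl
  ∏ₛ-cong {suc k} p = ⊛ₛ-cong (p Fin.zero) (∏ₛ-cong (p ∘ Fin.suc))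

  ⊛^-cong : ∀ {f g} n → f ≋ₛ g → f ⊛^ n ≋ₛ g ⊛^ n
  ⊛^-cong zero    p = λ _ → ≈-refl
  ⊛^-cong (suc n) p = ⊛ₛ-cong p (⊛^-cong n p)

  ⟨⟩ₛ-cong : ∀ {f f′ g g′} → f ≋ₛ f′ → g ≋ₛ g′ → f ⟨ g ⟩ ≋ₛ f′ ⟨ g′ ⟩
  ⟨⟩ₛ-cong p q n = ∑-cong (suc n) λ i → *-cong (p (toℕ i)) (⊛^-cong (toℕ i) q n)

  ∫₀-cong : ∀ {f g} → f ≋ₛ g → ∫₀ f ≋ₛ ∫₀ g
  ∫₀-cong p zero    = ≈-refl
  ∫₀-cong p (suc n) = *-congˡ (p n)

  deriv-∫₀ : ∀ f → deriv (∫₀ f) ≋ₛ f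
  deriv-∫₀ f n = ≈-trans (≈-sym (*-assoc _ _ _))
    (≈-trans (*-congʳ (proj₂ (proj₂ (inv (suc n))))) (*-identityˡ _))

  zeros : ℕ → List ℕ
  zeros N = List.replicate N 0

  sum-zeros : ∀ N → lsum (zeros N) ≡ 0
  sum-zeros zero    = ≡.refl
  sum-zeros (suc N) = sum-zeros N

  restrict : ℕ → FPS∞ → FPS
  restrict N F n = F (n ∷ zeros N)

  ⊛-zeros : ∀ N F G → (F ⊛∞ G) (zeros N) ≈ F (zeros N) * G (zeros N)
  ⊛-zeros zero    F G = ≈-refl
  ⊛-zeros (suc N) F G = ≈-trans (⊛-head F G (zeros N)) (⊛-zeros N _ _)

  1∞-zeros : ∀ N → 1∞ (zeros N) ≈ 1#
  1∞-zeros zero    = ≈-refl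
  1∞-zeros (suc N) = 1∞-zeros N

  Σy-zeros : ∀ N G → Σy G (zeros N) ≈ 0#
  Σy-zeros N G = ∑-zero (length (zeros N)) λ j → y-zeros (toℕ j) N (G (toℕ j))
    where
    y-zeros : ∀ j N F → (y[ j ]· F) (zeros N) ≈ 0#
    y-zeros j       zero    F = ≈-refl
    y-zeros zero    (suc N) F = ≈-refl
    y-zeros (suc j) (suc N) F = y-zeros j N (F ∘ (0 ∷_))

  restrict-^ : ∀ N F i → restrict N (F ⊛∞^ i) ≋ₛ restrict N F ⊛^ i
  restrict-^ N F zero    zero    = 1∞-zeros N
  restrict-^ N F zero    (suc n) = ≈-refl
  restrict-^ N F (suc i) n = ∑-cong (suc n) λ j → ≈-trans
    (⊛-zeros N (F ∘ (toℕ j ∷_)) ((F ⊛∞^ i) ∘ (n ∸ toℕ j ∷_)))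
    (*-congˡ {F (toℕ j ∷ zeros N)} (restrict-^ N F i (n ∸ toℕ j)))

  restrict-⟨⟩ : ∀ N f F → restrict N (f ⟨ F ⟩∞) ≋ₛ f ⟨ restrict N F ⟩
  restrict-⟨⟩ N f F n = ≈-trans
    (reflexive (≡.cong (λ m → ∑[ i ≤ m ] (f (toℕ i) * (F ⊛∞^ toℕ i) (n ∷ zeros N)))
      (≡.trans (≡.cong (n ℕ.+_) (sum-zeros N)) (ℕₚ.+-identityʳ n))))
    (∑-cong (suc n) λ i → *-congˡ {f (toℕ i)} (restrict-^ N F (toℕ i) n))

  1ₛ⟨⟩ : ∀ F → 1ₛ ⟨ F ⟩∞ ≋ 1∞
  1ₛ⟨⟩ F e = ≈-trans
    (+-cong (*-identityˡ (1∞ e)) (∑-zero (lsum e) λ i → zeroˡ ((F ⊛∞^ suc (toℕ i)) e)))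
    (+-identityʳ (1∞ e))

  slice : FPS∞ → FPS∞
  slice F = F ∘ (0 ∷_)

  slice-^ : ∀ F i → slice (F ⊛∞^ i) ≋ slice F ⊛∞^ i
  slice-^ F zero    e = ≈-refl
  slice-^ F (suc i) e = ≈-trans (⊛-head F (F ⊛∞^ i) e) (⊛-cong {slice F} (λ _ → ≈-refl) (slice-^ F i) e)

  slice-⟨⟩ : ∀ f F → slice (f ⟨ F ⟩∞) ≋ f ⟨ slice F ⟩∞
  slice-⟨⟩ f F e = ∑-cong (suc (lsum e)) λ i → *-congˡ {f (toℕ i)} (slice-^ F (toℕ i) e)

  ∂∂ : ∀ {k} → Vector ℕ k → FPS∞ → FPS∞
  ∂∂ j F = Vector.foldr ∂ F j

  ∂∂-cong : ∀ {k} (j : Vector ℕ k) {F G} → F ≋ G → ∂∂ j F ≋ ∂∂ j G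
  ∂∂-cong {zero}  j p e = p e
  ∂∂-cong {suc k} j p e = *-congˡ (∂∂-cong (j ∘ Fin.suc) p (raise (j Fin.zero) e))

  slice-∂∂ : ∀ {k} (j : Vector ℕ k) F → slice (∂∂ (suc ∘ j) F) ≋ ∂∂ j (slice F)
  slice-∂∂ {zero}  j F e = ≈-refl
  slice-∂∂ {suc k} j F e = *-congˡ (slice-∂∂ (j ∘ Fin.suc) F (raise (j Fin.zero) e))

  ∂₀^ : ℕ → FPS∞ → FPS∞
  ∂₀^ zero    F = F
  ∂₀^ (suc k) F = ∂₀^ k (∂ 0 F)

  ∂₀^-Agree : ∀ {N F G} k → (∀ n → Agree (suc N) n F G) → ∀ n → Agree (suc N) n (∂₀^ k F) (∂₀^ k G)
  ∂₀^-Agree zero    p = p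
  ∂₀^-Agree (suc k) p = ∂₀^-Agree k λ n → ∂-Agree (s≤s z≤n) (p (suc n))

  ∂₀^-comm : ∀ {N j} k F → j < N → ∀ n → Agree (suc N) n (∂ (suc j) (∂₀^ k F)) (∂₀^ k (∂ (suc j) F))
  ∂₀^-comm     zero    F j<N n = Agree-refl
  ∂₀^-comm {N} {j} (suc k) F j<N n = Agree-trans (∂₀^-comm k (∂ 0 F) j<N n)
    (∂₀^-Agree k (λ n e l s → ∂-comm j F e (≡.subst (0 <_) (≡.sym l) (s≤s z≤n))) n)

  ∂₀^-at0 : ∀ k F es → ∂₀^ k F (0 ∷ es) ≈ fromℕ (k !) * F (k ∷ es)
  ∂₀^-at0 zero    F es = ≈-sym (≈-trans (*-congʳ (+-identityʳ 1#)) (*-identityˡ _))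
  ∂₀^-at0 (suc k) F es = begin
    ∂₀^ k (∂ 0 F) (0 ∷ es)                          ≈⟨ ∂₀^-at0 k (∂ 0 F) es ⟩
    fromℕ (k !) * (fromℕ (suc k) * F (suc k ∷ es))  ≈⟨ *-assoc _ _ _ ⟨
    fromℕ (k !) * fromℕ (suc k) * F (suc k ∷ es)
      ≈⟨ *-congʳ (≈-trans (*-comm _ _) (≈-sym (SemiringMult.×1-homo-* semiring (suc k) (k !)))) ⟩
    fromℕ (suc k !) * F (suc k ∷ es) ∎

  raise-pad : ∀ j e → raise j (e ∷ʳ 0) ≡ raise j e ⊎ raise j (e ∷ʳ 0) ≡ raise j e ∷ʳ 0
  raise-pad zero    []      = inj₁ ≡.refl
  raise-pad zero    (_ ∷ _) = inj₂ ≡.refl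
  raise-pad (suc j) []      = inj₁ ≡.refl
  raise-pad (suc j) (x ∷ e) with raise-pad j e
  ... | inj₁ p = inj₁ (≡.cong (x ∷_) p)
  ... | inj₂ p = inj₂ (≡.cong (x ∷_) p)

  exponent-pad : ∀ j e → exponent j (e ∷ʳ 0) ≡ exponent j e
  exponent-pad zero    []      = ≡.refl
  exponent-pad zero    (_ ∷ _) = ≡.refl
  exponent-pad (suc j) []      = ≡.refl
  exponent-pad (suc j) (_ ∷ e) = exponent-pad j e

  ∂-pad : ∀ j {F} → RespectsPadding F → RespectsPadding (∂ j F)
  ∂-pad j {F} pad e = *-cong (reflexive (≡.cong (fromℕ ∘ suc) (exponent-pad j e))) (go (raise-pad j e))
    where
    go : raise j (e ∷ʳ 0) ≡ raise j e ⊎ raise j (e ∷ʳ 0) ≡ raise j e ∷ʳ 0 →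
      F (raise j (e ∷ʳ 0)) ≈ F (raise j e)
    go (inj₁ p) = reflexive (≡.cong F p)
    go (inj₂ p) = ≈-trans (reflexive (≡.cong F p)) (pad (raise j e))

  ∂∂-pad : ∀ {k} (j : Vector ℕ k) {F} → RespectsPadding F → RespectsPadding (∂∂ j F)
  ∂∂-pad {zero}  j pad = pad
  ∂∂-pad {suc k} j pad = ∂-pad (j Fin.zero) (∂∂-pad (j ∘ Fin.suc) pad)

  ⊛-pad : ∀ {F G} → RespectsPadding F → RespectsPadding G → RespectsPadding (F ⊛∞ G)
  ⊛-pad {F} {G} p q []       = ≈-trans (⊛-head F G []) (*-cong (p []) (q []))
  ⊛-pad {F} {G} p q (e ∷ es) = ∑-cong (suc e) λ i →
    ⊛-pad {F ∘ (toℕ i ∷_)} {G ∘ (e ∸ toℕ i ∷_)} (λ es → p (toℕ i ∷ es)) (λ es → q (e ∸ toℕ i ∷ es)) es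

  1∞-pad : RespectsPadding 1∞
  1∞-pad []           = ≈-refl
  1∞-pad (zero  ∷ es) = 1∞-pad es
  1∞-pad (suc _ ∷ es) = ≈-refl

  ^-pad : ∀ {F} i → RespectsPadding F → RespectsPadding (F ⊛∞^ i)
  ^-pad zero    p = 1∞-pad
  ^-pad (suc i) p = ⊛-pad p (^-pad i p)

  sum-pad : ∀ e → lsum (e ∷ʳ 0) ≡ lsum e
  sum-pad []      = ≡.refl
  sum-pad (n ∷ e) = ≡.cong (n ℕ.+_) (sum-pad e)

  ⟨⟩-pad : ∀ f {F} → RespectsPadding F → RespectsPadding (f ⟨ F ⟩∞)
  ⟨⟩-pad f {F} p e = ≈-trans
    (reflexive (≡.cong (λ m → ∑[ i ≤ m ] (f (toℕ i) * (F ⊛∞^ toℕ i) (e ∷ʳ 0))) (sum-pad e)))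
    (∑-cong (suc (lsum e)) λ i → *-congˡ {f (toℕ i)} (^-pad (toℕ i) p e))

  zeros-pad : ∀ {F} → RespectsPadding F → ∀ N → F (zeros N) ≈ F []
  zeros-pad p zero = ≈-refl
  zeros-pad {F} p (suc N) = ≈-trans (reflexive (≡.cong F (snoc N))) (≈-trans (p (zeros N)) (zeros-pad p N))
    where
    snoc : ∀ N → zeros (suc N) ≡ zeros N ∷ʳ 0
    snoc zero    = ≡.refl
    snoc (suc N) = ≡.cong (0 ∷_) (snoc N)

  pad⇒ZeroConst : ∀ {F} → RespectsPadding F → F [] ≈ 0# → ∀ {N} → ZeroConst N F
  pad⇒ZeroConst {F} p F₀ e _ (s≤s s) = ≈-trans (reflexive (≡.cong F (all-zero e s)))
    (≈-trans (zeros-pad p (length e)) F₀)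
    where
    all-zero : ∀ e → lsum e ≤ 0 → e ≡ zeros (length e)
    all-zero []         _ = ≡.refl
    all-zero (zero ∷ e) s = ≡.cong (0 ∷_) (all-zero e s)

  antideriv : FPS → FPS → FPS
  antideriv f Φ zero    = f 0
  antideriv f Φ (suc n) = ∫₀ (deriv f ⊛ Φ) (suc n)

  deriv-antideriv : ∀ f Φ → deriv (antideriv f Φ) ≋ₛ deriv f ⊛ Φ
  deriv-antideriv f Φ = deriv-∫₀ (deriv f ⊛ Φ)

  antideriv-1ₛ : ∀ f → antideriv f 1ₛ ≋ₛ f
  antideriv-1ₛ f zero    = ≈-refl
  antideriv-1ₛ f (suc n) = begin
    recip (suc n) * (deriv f ⊛ 1ₛ) n           ≈⟨ *-congˡ (CommutativeRing.*-identityʳ FPS-ring (deriv f) n) ⟩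
    recip (suc n) * (fromℕ (suc n) * f (suc n)) ≈⟨ *-assoc _ _ _ ⟨
    recip (suc n) * fromℕ (suc n) * f (suc n)   ≈⟨ *-congʳ (proj₁ (proj₂ (inv (suc n)))) ⟩
    1# * f (suc n)                              ≈⟨ *-identityˡ _ ⟩
    f (suc n) ∎

  max : ∀ {k} → Vector ℕ k → ℕ
  max = Vector.foldr ℕ._⊔_ 0

  ≤-max : ∀ {k} (j : Vector ℕ k) i → j i ≤ max j
  ≤-max j Fin.zero    = ℕₚ.m≤m⊔n _ _
  ≤-max j (Fin.suc i) = ℕₚ.m≤n⇒m≤o⊔n _ (≤-max (j ∘ Fin.suc) i)

  -- Lagrange inversion; the variable w is y₀ and yⱼ becomes yⱼ₊₁.

  module Lagrange (Ψ : FPS) (Ψ₀ : Ψ 0 ≈ 0#) (Ψ₁ : Ψ 1 ≈ 1#) (φ : ℕ → FPS) where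

    ψ : ℕ → FPS
    ψ zero    = 1ₛ
    ψ (suc j) = φ j

    module Base = FixedPoint Ψ Ψ₀ Ψ₁ φ
    open FixedPoint Ψ Ψ₀ Ψ₁ ψ public

    W : FPS∞
    W = solution

    rhs-restrict : ∀ N F → restrict N (rhs F) ≋ₛ Xₛ
    rhs-restrict N F n = ≈-trans (+-cong (head n) (Σy-zeros N (λ j → (ψ (suc j) ⟨ F ⟩∞) ∘ (n ∷_)))) (+-identityʳ _)
      where
      head : ∀ n → (y[ 0 ]· 1ₛ ⟨ F ⟩∞) (n ∷ zeros N) ≈ Xₛ n
      head zero          = ≈-refl
      head (suc zero)    = ≈-trans (1ₛ⟨⟩ F (0 ∷ zeros N)) (1∞-zeros N)
      head (suc (suc n)) = 1ₛ⟨⟩ F (suc n ∷ zeros N)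

    restrict-inverse : ∀ N → Ψ ⟨ restrict N W ⟩ ≋ₛ Xₛ
    restrict-inverse N n = begin
      (Ψ ⟨ restrict N W ⟩) n     ≈⟨ restrict-⟨⟩ N Ψ W n ⟨
      (Ψ ⟨ W ⟩∞) (n ∷ zeros N)   ≈⟨ solution-solves (n ∷ zeros N) ≡.refl ⟩
      rhs W (n ∷ zeros N)        ≈⟨ rhs-restrict N W n ⟩
      Xₛ n ∎

    inverse-unique : ∀ {g h} → g 0 ≈ 0# → h 0 ≈ 0# → Ψ ⟨ g ⟩ ≋ₛ Xₛ → Ψ ⟨ h ⟩ ≋ₛ Xₛ → g ≋ₛ h
    inverse-unique {g} {h} g₀ h₀ p q n =
      unique (zeroConst g₀) (zeroConst h₀) (solves p) (solves q) (suc (lsum (n ∷ []))) (n ∷ []) ≡.refl ℕₚ.≤-refl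
      where
      zeroConst : ∀ {g} → g 0 ≈ 0# → ZeroConst 1 (lift g)
      zeroConst g₀ (zero ∷ []) l s = g₀
      zeroConst g₀ (suc n ∷ []) l (s≤s ())
      solves : ∀ {g} → Ψ ⟨ g ⟩ ≋ₛ Xₛ → Solves 1 (lift g)
      solves {g} p (n ∷ []) l = begin
        (Ψ ⟨ lift g ⟩∞) (n ∷ [])  ≈⟨ restrict-⟨⟩ 0 Ψ (lift g) n ⟩
        (Ψ ⟨ g ⟩) n               ≈⟨ p n ⟩
        Xₛ n                      ≈⟨ rhs-restrict 0 (lift g) n ⟨
        rhs (lift g) (n ∷ []) ∎

    restrict-unique : ∀ {g} → g 0 ≈ 0# → Ψ ⟨ g ⟩ ≋ₛ Xₛ → ∀ N → restrict N W ≋ₛ g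
    restrict-unique g₀ p N = inverse-unique
      (solution-ZeroConst (0 ∷ zeros N) ≡.refl (s≤s (ℕₚ.≤-reflexive (sum-zeros N)))) g₀
      (restrict-inverse N) p

    slice-unique : ∀ {R} → (∀ {N} → ZeroConst N R) → (∀ {N} → Base.Solves N R) → slice W ≋ R
    slice-unique {R} R₀ R-solves e =
      Base.unique (λ e l → solution-ZeroConst (0 ∷ e) (≡.cong suc l)) R₀ slice-solves R-solves
        (suc (lsum e)) e ≡.refl ℕₚ.≤-refl
      where
      slice-solves : ∀ {N} → Base.Solves N (slice W)
      slice-solves e l = begin
        (Ψ ⟨ slice W ⟩∞) e  ≈⟨ slice-⟨⟩ Ψ W e ⟨
        (Ψ ⟨ W ⟩∞) (0 ∷ e)  ≈⟨ solution-solves (0 ∷ e) ≡.refl ⟩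
        0# + Σy (λ j → slice (φ j ⟨ W ⟩∞)) e  ≈⟨ +-identityˡ _ ⟩
        Σy (λ j → slice (φ j ⟨ W ⟩∞)) e  ≈⟨ Σy-cong (λ j → slice-⟨⟩ (φ j) W) e ⟩
        Base.rhs (slice W) e ∎

    module _ {N : ℕ} where

      private
        infix 4 _~_
        _~_ : FPS∞ → FPS∞ → Set r
        F ~ G = ∀ n → Agree (suc N) n F G

        W₀ : ZeroConst (suc N) W
        W₀ = solution-ZeroConst

        Q : FPS∞
        Q = deriv Ψ ⟨ W ⟩∞ ⊞ ⊟ Σy (λ i → deriv (ψ i) ⟨ W ⟩∞)

      Q-∂W : ∀ {j} → j < suc N → Q ⊛∞ ∂ j W ~ ψ j ⟨ W ⟩∞
      Q-∂W {j} j<N n e l s = begin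
        (Q ⊛∞ ∂ j W) e
          ≈⟨ ⊛-distribʳ (∂ j W) (deriv Ψ ⟨ W ⟩∞) (⊟ S) e ⟩
        (deriv Ψ ⟨ W ⟩∞ ⊛∞ ∂ j W) e + (⊟ S ⊛∞ ∂ j W) e
          ≈⟨ +-cong (≈-sym (chain-rule j<N W₀ n Ψ e l s)) (⊟-⊛ S (∂ j W) e) ⟩
        ∂ j (Ψ ⟨ W ⟩∞) e + - (S ⊛∞ ∂ j W) e
          ≈⟨ +-congʳ (∂-Agree {suc N} {n} {j} j<N (λ e l _ → solution-solves e l) e l s) ⟩
        ∂ j (rhs W) e + - (S ⊛∞ ∂ j W) e
          ≈⟨ +-congʳ (∂-Σy j (λ i → ψ i ⟨ W ⟩∞) e (≡.subst (j <_) (≡.sym l) j<N)) ⟩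
        (ψ j ⟨ W ⟩∞) e + Σy (λ i → ∂ j (ψ i ⟨ W ⟩∞)) e + - (S ⊛∞ ∂ j W) e
          ≈⟨ +-congʳ (+-congˡ (≈-trans
               (Σy-step (λ i → chain-rule j<N W₀ n (ψ i)) e l (ℕₚ.m≤n⇒m≤1+n s))
               (≈-sym (Σy-⊛ (λ i → deriv (ψ i) ⟨ W ⟩∞) (∂ j W) e)))) ⟩
        (ψ j ⟨ W ⟩∞) e + (S ⊛∞ ∂ j W) e + - (S ⊛∞ ∂ j W) e
          ≈⟨ +-assoc _ _ _ ⟩
        (ψ j ⟨ W ⟩∞) e + ((S ⊛∞ ∂ j W) e + - (S ⊛∞ ∂ j W) e)
          ≈⟨ ≈-trans (+-congˡ (-‿inverseʳ _)) (+-identityʳ _) ⟩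
        (ψ j ⟨ W ⟩∞) e ∎
        where
        S = Σy (λ i → deriv (ψ i) ⟨ W ⟩∞)

      ∂W : ∀ {j} → j < suc N → ∂ j W ~ ψ j ⟨ W ⟩∞ ⊛∞ ∂ 0 W
      ∂W {j} j<N n e l s = begin
        (∂ j W) e
          ≈⟨ ⊛-identityˡ (∂ j W) e ⟨
        (1∞ ⊛∞ ∂ j W) e
          ≈⟨ (Agree-⊛ (Agree-trans (Q-∂W (s≤s z≤n) n) (≋⇒Agree (1ₛ⟨⟩ W))) (Agree-refl {F = ∂ j W})) e l s ⟨
        ((Q ⊛∞ ∂ 0 W) ⊛∞ ∂ j W) e
          ≈⟨ (Agree-⊛ (≋⇒Agree (⊛-comm Q (∂ 0 W))) (Agree-refl {F = ∂ j W})) e l s ⟩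
        ((∂ 0 W ⊛∞ Q) ⊛∞ ∂ j W) e
          ≈⟨ ⊛-assoc (∂ 0 W) Q (∂ j W) e ⟩
        (∂ 0 W ⊛∞ (Q ⊛∞ ∂ j W)) e
          ≈⟨ (Agree-⊛ (Agree-refl {F = ∂ 0 W}) (Q-∂W j<N n)) e l s ⟩
        (∂ 0 W ⊛∞ ψ j ⟨ W ⟩∞) e
          ≈⟨ ⊛-comm (∂ 0 W) _ e ⟩
        (ψ j ⟨ W ⟩∞ ⊛∞ ∂ 0 W) e ∎

      ∂-⟨W⟩ : ∀ {j} → j < N → ∀ g h → deriv h ≋ₛ deriv g ⊛ φ j → ∂ (suc j) (g ⟨ W ⟩∞) ~ ∂ 0 (h ⟨ W ⟩∞)
      ∂-⟨W⟩ {j} j<N g h h′ n e l s = begin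
        (∂ (suc j) (g ⟨ W ⟩∞)) e
          ≈⟨ (chain-rule (s≤s j<N) W₀ n g) e l s ⟩
        (deriv g ⟨ W ⟩∞ ⊛∞ ∂ (suc j) W) e
          ≈⟨ (Agree-⊛ (Agree-refl {F = deriv g ⟨ W ⟩∞}) (∂W (s≤s j<N) n)) e l s ⟩
        (deriv g ⟨ W ⟩∞ ⊛∞ (φ j ⟨ W ⟩∞ ⊛∞ ∂ 0 W)) e
          ≈⟨ ⊛-assoc (deriv g ⟨ W ⟩∞) (φ j ⟨ W ⟩∞) (∂ 0 W) e ⟨
        ((deriv g ⟨ W ⟩∞ ⊛∞ φ j ⟨ W ⟩∞) ⊛∞ ∂ 0 W) e
          ≈⟨ (Agree-⊛ (⟨⟩-⊛ n (deriv g) (φ j)) (Agree-refl {F = ∂ 0 W})) e l s ⟨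
        ((deriv g ⊛ φ j) ⟨ W ⟩∞ ⊛∞ ∂ 0 W) e
          ≈⟨ (Agree-⊛ (≋⇒Agree (⟨⟩-cong h′ W)) (Agree-refl {F = ∂ 0 W})) e l s ⟨
        (deriv h ⟨ W ⟩∞ ⊛∞ ∂ 0 W) e
          ≈⟨ (chain-rule (s≤s z≤n) W₀ n h) e l s ⟨
        ∂ 0 (h ⟨ W ⟩∞) e ∎
        where
        open Horner W₀

      ∂∂-⟨W⟩ : ∀ {k} (j : Vector ℕ k) → (∀ i → j i < N) → ∀ f h →
        (k ≡ 0 → h ≋ₛ f) → deriv h ≋ₛ deriv f ⊛ ∏ₛ (φ ∘ j) →
        ∂∂ (suc ∘ j) (f ⟨ W ⟩∞) ~ ∂₀^ k (h ⟨ W ⟩∞)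
      ∂∂-⟨W⟩ {zero}  j j<N f h h≋f h′ n = ≋⇒Agree (⟨⟩-cong (λ m → ≈-sym (h≋f ≡.refl m)) W)
      ∂∂-⟨W⟩ {suc k} j j<N f h _   h′ n e l s = begin
        ∂ (suc j₀) (∂∂ (suc ∘ j ∘ Fin.suc) (f ⟨ W ⟩∞)) e
          ≈⟨ ∂-Agree (s≤s (j<N Fin.zero))
               (∂∂-⟨W⟩ (j ∘ Fin.suc) (j<N ∘ Fin.suc) f g g≋f (deriv-antideriv f Φ) (suc n)) e l s ⟩
        ∂ (suc j₀) (∂₀^ k (g ⟨ W ⟩∞)) e
          ≈⟨ (∂₀^-comm k (g ⟨ W ⟩∞) (j<N Fin.zero) n) e l s ⟩
        ∂₀^ k (∂ (suc j₀) (g ⟨ W ⟩∞)) e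
          ≈⟨ (∂₀^-Agree k (∂-⟨W⟩ (j<N Fin.zero) g h g-h) n) e l s ⟩
        ∂₀^ k (∂ 0 (h ⟨ W ⟩∞)) e ∎
        where
        module FPS = CommutativeRing FPS-ring
        j₀ = j Fin.zero
        Φ = ∏ₛ (φ ∘ j ∘ Fin.suc)
        g = antideriv f Φ
        g≋f : k ≡ 0 → g ≋ₛ f
        g≋f ≡.refl = antideriv-1ₛ f
        g-h : deriv h ≋ₛ deriv g ⊛ φ j₀
        g-h = FPS.trans h′ (FPS.trans (FPS.*-congˡ {deriv f} (FPS.*-comm (φ j₀) Φ))
          (FPS.trans (FPS.sym (FPS.*-assoc (deriv f) Φ (φ j₀))) (FPS.*-congʳ {φ j₀} (FPS.sym (deriv-antideriv f Φ)))))

    lagrange : ∀ {k} (j : Vector ℕ (suc k)) f {R g} →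
      RespectsPadding R → R [] ≈ 0# → (∀ {N} → Base.Solves N R) →
      g 0 ≈ 0# → Ψ ⟨ g ⟩ ≋ₛ Xₛ →
      at0 (∂∂ j (f ⟨ R ⟩∞)) ≈
        fromℕ (suc k !) * (∫₀ (deriv f ⊛ ∏ₛ (φ ∘ j)) ⟨ g ⟩) (suc k)
    lagrange {k} j f {R} {g} R-pad R₀ R-solves g₀ g-inv = begin
      ∂∂ j (f ⟨ R ⟩∞) []
        ≈⟨ zeros-pad (∂∂-pad j (⟨⟩-pad f R-pad)) N ⟨
      ∂∂ j (f ⟨ R ⟩∞) (zeros N)
        ≈⟨ ∂∂-cong j (λ e → ≈-trans (slice-⟨⟩ f W e)
             (Agree-⟨⟩ {length e} f (λ e _ _ → slice-unique (pad⇒ZeroConst R-pad R₀) R-solves e)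
               e ≡.refl ℕₚ.≤-refl)) (zeros N) ⟨
      ∂∂ j (slice (f ⟨ W ⟩∞)) (zeros N)
        ≈⟨ slice-∂∂ j (f ⟨ W ⟩∞) (zeros N) ⟨
      ∂∂ (suc ∘ j) (f ⟨ W ⟩∞) (0 ∷ zeros N)
        ≈⟨ ∂∂-⟨W⟩ {N} j (λ i → s≤s (≤-max j i)) f h (λ ()) (deriv-∫₀ (deriv f ⊛ ∏ₛ (φ ∘ j)))
             (suc (lsum (zeros N))) (0 ∷ zeros N) (≡.cong suc (Listₚ.length-replicate N)) ℕₚ.≤-refl ⟩
      ∂₀^ (suc k) (h ⟨ W ⟩∞) (0 ∷ zeros N)
        ≈⟨ ∂₀^-at0 (suc k) (h ⟨ W ⟩∞) (zeros N) ⟩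
      fromℕ (suc k !) * (h ⟨ W ⟩∞) (suc k ∷ zeros N)
        ≈⟨ *-congˡ (≈-trans (restrict-⟨⟩ N h W (suc k))
             (⟨⟩ₛ-cong {h} (λ _ → ≈-refl) (restrict-unique g₀ g-inv N) (suc k))) ⟩
      fromℕ (suc k !) * (h ⟨ g ⟩) (suc k) ∎
      where
      h = ∫₀ (deriv f ⊛ ∏ₛ (φ ∘ j))
      N = suc (max j)

  ∑-single : ∀ {n} (g : ℕ → Carrier) m → m < n → (∀ i → i < n → i ≢ m → g i ≈ 0#) →
    ∑[ i < n ] g (toℕ i) ≈ g m
  ∑-single {suc n} g zero    m<n off = ≈-trans
    (+-congˡ (∑-zero n λ i → off (suc (toℕ i)) (s≤s (Finₚ.toℕ<n i)) λ ())) (+-identityʳ _)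
  ∑-single {suc n} g (suc m) (s≤s m<n) off = ≈-trans
    (+-cong (off 0 (s≤s z≤n) λ ())
      (∑-single (g ∘ suc) m m<n λ i i<n i≢m → off (suc i) (s≤s i<n) (i≢m ∘ ℕₚ.suc-injective)))
    (+-identityˡ _)

  -- The expansion of I(b,ℓ) in powers of ℓ²

  X-_⊛_ : Carrier → FPS → FPS
  (X- a ⊛ g) zero    = - a * g 0
  (X- a ⊛ g) (suc q) = g q + - a * g (suc q)

  fromRoots : ∀ {p} → Vector Carrier p → FPS
  fromRoots {zero}  a = 1ₛ
  fromRoots {suc p} a = X- a Fin.zero ⊛ fromRoots (a ∘ Fin.suc)

  fromRoots-eval : ∀ {p} (a : Vector Carrier p) x n → p ≤ n →
    ∑[ q ≤ n ] (fromRoots a (toℕ q) * x ^ toℕ q) ≈ ∏[ m < p ] (x - a m)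
  fromRoots-eval {zero} a x n _ = ≈-trans
    (+-cong (*-identityˡ 1#) (∑-zero n λ q → zeroˡ (x ^ suc (toℕ q)))) (+-identityʳ 1#)
  fromRoots-eval {suc p} a x (suc n) (s≤s p≤n) = begin
    - a₀ * g 0 * 1# + ∑[ q ≤ n ] ((g (toℕ q) + - a₀ * g (suc (toℕ q))) * x ^ suc (toℕ q))
      ≈⟨ +-congˡ (∑-cong (suc n) λ q → ≈-trans (distribʳ (x ^ suc (toℕ q)) (g (toℕ q)) (- a₀ * g (suc (toℕ q))))
           (+-cong (x∙yz≈y∙xz (g (toℕ q)) x (x ^ toℕ q)) (*-assoc (- a₀) (g (suc (toℕ q))) (x ^ suc (toℕ q))))) ⟩
    - a₀ * g 0 * 1# + ∑[ q ≤ n ] (x * u (toℕ q) + - a₀ * u (suc (toℕ q)))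
      ≈⟨ +-cong (*-assoc _ _ _) (∑-distrib-+ {suc n} (λ q → x * u (toℕ q)) (λ q → - a₀ * u (suc (toℕ q)))) ⟩
    - a₀ * u 0 + (∑[ q ≤ n ] (x * u (toℕ q)) + ∑[ q ≤ n ] (- a₀ * u (suc (toℕ q))))
      ≈⟨ CommutativeSemigroupProperties.x∙yz≈y∙xz +-commutativeSemigroup _ _ _ ⟩
    ∑[ q ≤ n ] (x * u (toℕ q)) + ∑[ q ≤ suc n ] (- a₀ * u (toℕ q))
      ≈⟨ +-cong (*-distribˡ-sum {suc n} x (λ q → u (toℕ q))) (*-distribˡ-sum {suc (suc n)} (- a₀) (λ q → u (toℕ q))) ⟨
    x * ∑[ q ≤ n ] u (toℕ q) + - a₀ * ∑[ q ≤ suc n ] u (toℕ q)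
      ≈⟨ +-cong (*-congˡ (fromRoots-eval (a ∘ Fin.suc) x n p≤n))
           (*-congˡ (fromRoots-eval (a ∘ Fin.suc) x (suc n) (ℕₚ.m≤n⇒m≤1+n p≤n))) ⟩
    x * Π + - a₀ * Π
      ≈⟨ distribʳ _ _ _ ⟨
    (x - a₀) * Π ∎
    where
    a₀ = a Fin.zero
    g = fromRoots (a ∘ Fin.suc)
    u : ℕ → Carrier
    u q = g q * x ^ q
    Π = ∏[ m < p ] (x - a (Fin.suc m))

  fromRoots-vanish : ∀ {p} (a : Vector Carrier p) q → p < q → fromRoots a q ≈ 0#
  fromRoots-vanish {zero}  a (suc q) _ = ≈-refl
  fromRoots-vanish {suc p} a (suc q) (s≤s p<q) = ≈-trans
    (+-cong (fromRoots-vanish (a ∘ Fin.suc) q p<q)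
      (≈-trans (*-congˡ (fromRoots-vanish (a ∘ Fin.suc) (suc q) (ℕₚ.m<n⇒m<1+n p<q))) (zeroʳ _)))
    (+-identityʳ 0#)

  fromRoots-monic : ∀ {p} (a : Vector Carrier p) → fromRoots a p ≈ 1#
  fromRoots-monic {zero}  a = ≈-refl
  fromRoots-monic {suc p} a = ≈-trans
    (+-cong (fromRoots-monic (a ∘ Fin.suc))
      (≈-trans (*-congˡ (fromRoots-vanish (a ∘ Fin.suc) (suc p) ℕₚ.≤-refl)) (zeroʳ _)))
    (+-identityʳ 1#)

  G : ℕ → ℕ → FPS
  G b q p = recip! p * recip! p * fromRoots {p} (λ m → (fromℕ b - fromℕ (toℕ m)) ^ 2) q

  I-expand : ∀ b ℓ p n → p ≤ n → I b ℓ p ≈ ∑[ q ≤ n ] ((fromℕ ℓ ^ 2) ^ toℕ q * G b (toℕ q) p)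
  I-expand b ℓ p n p≤n = begin
    R * ∏[ m < p ] (x - a m)
      ≈⟨ *-congˡ (fromRoots-eval a x n p≤n) ⟨
    R * ∑[ q ≤ n ] (fromRoots a (toℕ q) * x ^ toℕ q)
      ≈⟨ *-distribˡ-sum {suc n} R (λ q → fromRoots a (toℕ q) * x ^ toℕ q) ⟩
    ∑[ q ≤ n ] (R * (fromRoots a (toℕ q) * x ^ toℕ q))
      ≈⟨ ∑-cong (suc n) (λ q → ≈-trans (≈-sym (*-assoc R (fromRoots a (toℕ q)) (x ^ toℕ q)))
           (*-comm (R * fromRoots a (toℕ q)) (x ^ toℕ q))) ⟩
    ∑[ q ≤ n ] (x ^ toℕ q * G b (toℕ q) p) ∎
    where
    R = recip! p * recip! p
    x = fromℕ ℓ ^ 2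
    a : Vector Carrier p
    a m = (fromℕ b - fromℕ (toℕ m)) ^ 2

  monomial : ∀ {m} → Vector Carrier m → Vec ℕ m → Carrier
  monomial {m} x e = ∏[ i < m ] (x i ^ Vec.lookup e i)

  ∏ₑ : ∀ {m} → (ℕ → FPS) → Vec ℕ m → FPS
  ∏ₑ A e = ∏ₛ (λ i → A (Vec.lookup e i))

  module Box (d : ℕ) where

    ∑B : ∀ {m} → (Vec ℕ m → Carrier) → Carrier
    ∑B {zero}  g = g []
    ∑B {suc m} g = ∑[ q ≤ d ] ∑B (λ e → g (toℕ q ∷ e))

    ∑B-cong : ∀ {m} {g h : Vec ℕ m → Carrier} → (∀ e → g e ≈ h e) → ∑B g ≈ ∑B h
    ∑B-cong {zero}  p = p []
    ∑B-cong {suc m} p = ∑-cong (suc d) λ q → ∑B-cong (λ e → p (toℕ q ∷ e))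

    ∑B-zero : ∀ {m} {g : Vec ℕ m → Carrier} → (∀ e → g e ≈ 0#) → ∑B g ≈ 0#
    ∑B-zero {zero}  p = p []
    ∑B-zero {suc m} p = ∑-zero (suc d) λ q → ∑B-zero (λ e → p (toℕ q ∷ e))

    ∑B-distribˡ : ∀ {m} a (g : Vec ℕ m → Carrier) → a * ∑B g ≈ ∑B (λ e → a * g e)
    ∑B-distribˡ {zero}  a g = ≈-refl
    ∑B-distribˡ {suc m} a g = ≈-trans
      (*-distribˡ-sum {suc d} a (λ q → ∑B (λ e → g (toℕ q ∷ e))))
      (∑-cong (suc d) λ q → ∑B-distribˡ a (λ e → g (toℕ q ∷ e)))

    ∑B-∑ : ∀ {m} n (g : Vec ℕ m → Vector Carrier n) →
      sum (λ i → ∑B (λ e → g e i)) ≈ ∑B (λ e → sum (g e))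
    ∑B-∑ {zero}  n g = ≈-refl
    ∑B-∑ {suc m} n g = ≈-trans
      (∑-comm {n} {suc d} (λ i q → ∑B (λ e → g (toℕ q ∷ e) i)))
      (∑-cong (suc d) λ q → ∑B-∑ n (λ e → g (toℕ q ∷ e)))

    ∑B-single : ∀ {m} (g : Vec ℕ m → Carrier) e → Vec.sum e ≤ d →
      (∀ e′ → e′ ≢ e → g e′ ≈ 0#) → ∑B g ≈ g e
    ∑B-single g []      _ off = ≈-refl
    ∑B-single g (q ∷ e) s off = ≈-trans
      (∑-single (λ q → ∑B (λ e → g (q ∷ e))) q (s≤s (ℕₚ.m+n≤o⇒m≤o q s))
        λ q′ _ q′≢q → ∑B-zero λ e′ → off (q′ ∷ e′) (q′≢q ∘ Vecₚ.∷-injectiveˡ))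
      (∑B-single (λ e → g (q ∷ e)) e (ℕₚ.m+n≤o⇒n≤o q s)
        λ e′ e′≢e → off (q ∷ e′) (e′≢e ∘ Vecₚ.∷-injectiveʳ))

    ∏-expand : ∀ {m} (A : ℕ → FPS) (x : Vector Carrier m) (F : Vector FPS m) →
      (∀ i p → p ≤ d → F i p ≈ ∑[ q ≤ d ] (x i ^ toℕ q * A (toℕ q) p)) →
      ∀ n → n ≤ d → ∏ₛ F n ≈ ∑B (λ e → monomial x e * ∏ₑ A e n)
    ∏-expand {zero}  A x F p n n≤d = ≈-sym (*-identityˡ (1ₛ n))
    ∏-expand {suc m} A x F p n n≤d = begin
      ∑[ i ≤ n ] (F₀ (toℕ i) * ∏ₛ F₁ (n ∸ toℕ i))
        ≈⟨ ∑-cong (suc n) (λ i → *-cong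
             (p Fin.zero (toℕ i) (ℕₚ.≤-trans (Finₚ.toℕ≤pred[n] i) n≤d))
             (∏-expand A x₁ F₁ (p ∘ Fin.suc) (n ∸ toℕ i) (ℕₚ.≤-trans (ℕₚ.m∸n≤m n (toℕ i)) n≤d))) ⟩
      ∑[ i ≤ n ] (∑[ q ≤ d ] a q i * ∑B (t i))
        ≈⟨ ∑-cong (suc n) (λ i → *-distribʳ-sum {suc d} (∑B (t i)) (λ q → a q i)) ⟩
      ∑[ i ≤ n ] ∑[ q ≤ d ] (a q i * ∑B (t i))
        ≈⟨ ∑-comm {suc n} {suc d} (λ i q → a q i * ∑B (t i)) ⟩
      ∑[ q ≤ d ] ∑[ i ≤ n ] (a q i * ∑B (t i))
        ≈⟨ ∑-cong (suc d) (λ q → ≈-trans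
             (∑-cong (suc n) λ i → ∑B-distribˡ (a q i) (t i))
             (∑B-∑ (suc n) λ e i → a q i * t i e)) ⟩
      ∑[ q ≤ d ] ∑B (λ e → ∑[ i ≤ n ] (a q i * t i e))
        ≈⟨ ∑-cong (suc d) (λ q → ∑B-cong λ e → ≈-trans
             (∑-cong (suc n) λ i → *-interchange (x₀ ^ toℕ q) (A (toℕ q) (toℕ i)) (monomial x₁ e) (∏ₑ A e (n ∸ toℕ i)))
             (≈-sym (*-distribˡ-sum {suc n} (x₀ ^ toℕ q * monomial x₁ e) λ i → A (toℕ q) (toℕ i) * ∏ₑ A e (n ∸ toℕ i)))) ⟩
      ∑B (λ e → monomial x e * ∏ₑ A e n) ∎
      where
      F₀ = F Fin.zero
      F₁ = F ∘ Fin.suc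
      x₀ = x Fin.zero
      x₁ = x ∘ Fin.suc
      a : Fin (suc d) → Fin (suc n) → Carrier
      a q i = x₀ ^ toℕ q * A (toℕ q) (toℕ i)
      t : Fin (suc n) → Vec ℕ m → Carrier
      t i e = monomial x₁ e * ∏ₑ A e (n ∸ toℕ i)
      *-interchange = CommutativeSemigroupProperties.interchange *-commutativeSemigroup

  -- Polynomial dependence on b

  polyEval : List Carrier → Carrier → Carrier
  polyEval []       x = 0#
  polyEval (a ∷ as) x = a + x * polyEval as x

  IsPoly : (ℕ → Carrier) → Set (c ⊔ r)
  IsPoly h = Σ[ as ∈ List Carrier ] (∀ b → h b ≈ polyEval as (fromℕ b))

  addₚ : List Carrier → List Carrier → List Carrier
  addₚ []       bs       = bs
  addₚ (a ∷ as) []       = a ∷ as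
  addₚ (a ∷ as) (b ∷ bs) = a + b ∷ addₚ as bs

  polyEval-add : ∀ as bs x → polyEval (addₚ as bs) x ≈ polyEval as x + polyEval bs x
  polyEval-add []       bs       x = ≈-sym (+-identityˡ _)
  polyEval-add (a ∷ as) []       x = ≈-sym (+-identityʳ _)
  polyEval-add (a ∷ as) (b ∷ bs) x = begin
    a + b + x * polyEval (addₚ as bs) x
      ≈⟨ +-congˡ (≈-trans (*-congˡ (polyEval-add as bs x)) (distribˡ _ _ _)) ⟩
    a + b + (x * polyEval as x + x * polyEval bs x)
      ≈⟨ interchange _ _ _ _ ⟩
    a + x * polyEval as x + (b + x * polyEval bs x) ∎

  polyEval-scale : ∀ a bs x → polyEval (List.map (a *_) bs) x ≈ a * polyEval bs x
  polyEval-scale a []       x = ≈-sym (zeroʳ a)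
  polyEval-scale a (b ∷ bs) x = ≈-trans
    (+-congˡ (≈-trans (*-congˡ (polyEval-scale a bs x)) (x∙yz≈y∙xz _ _ _)))
    (≈-sym (distribˡ _ _ _))

  mulₚ : List Carrier → List Carrier → List Carrier
  mulₚ []       bs = []
  mulₚ (a ∷ as) bs = addₚ (List.map (a *_) bs) (0# ∷ mulₚ as bs)

  polyEval-mul : ∀ as bs x → polyEval (mulₚ as bs) x ≈ polyEval as x * polyEval bs x
  polyEval-mul []       bs x = ≈-sym (zeroˡ _)
  polyEval-mul (a ∷ as) bs x = begin
    polyEval (addₚ (List.map (a *_) bs) (0# ∷ mulₚ as bs)) x
      ≈⟨ polyEval-add (List.map (a *_) bs) (0# ∷ mulₚ as bs) x ⟩
    polyEval (List.map (a *_) bs) x + (0# + x * polyEval (mulₚ as bs) x)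
      ≈⟨ +-cong (polyEval-scale a bs x) (+-identityˡ _) ⟩
    a * polyEval bs x + x * polyEval (mulₚ as bs) x
      ≈⟨ +-congˡ (≈-trans (*-congˡ (polyEval-mul as bs x)) (≈-sym (*-assoc _ _ _))) ⟩
    a * polyEval bs x + x * polyEval as x * polyEval bs x
      ≈⟨ distribʳ _ _ _ ⟨
    (a + x * polyEval as x) * polyEval bs x ∎

  poly-const : ∀ a → IsPoly (λ _ → a)
  poly-const a = a ∷ [] , λ b → ≈-sym (≈-trans (+-congˡ (zeroʳ _)) (+-identityʳ a))

  poly-fromℕ : IsPoly fromℕ
  poly-fromℕ = 0# ∷ 1# ∷ [] , λ b → ≈-sym (≈-trans (+-identityˡ _)
    (≈-trans (*-congˡ (≈-trans (+-congˡ (zeroʳ _)) (+-identityʳ _))) (*-identityʳ _)))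

  poly-resp : ∀ {g h} → (∀ b → g b ≈ h b) → IsPoly h → IsPoly g
  poly-resp g≈h (as , p) = as , λ b → ≈-trans (g≈h b) (p b)

  poly-+ : ∀ {g h} → IsPoly g → IsPoly h → IsPoly (λ b → g b + h b)
  poly-+ (as , p) (bs , q) = addₚ as bs , λ b → ≈-trans (+-cong (p b) (q b)) (≈-sym (polyEval-add as bs _))

  poly-* : ∀ {g h} → IsPoly g → IsPoly h → IsPoly (λ b → g b * h b)
  poly-* (as , p) (bs , q) = mulₚ as bs , λ b → ≈-trans (*-cong (p b) (q b)) (≈-sym (polyEval-mul as bs _))

  poly-neg : ∀ {g} → IsPoly g → IsPoly (λ b → - g b)
  poly-neg p = poly-resp (λ b → ≈-sym (RingProperties.-1*x≈-x ring _)) (poly-* (poly-const (- 1#)) p)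

  poly-^ : ∀ {g} n → IsPoly g → IsPoly (λ b → g b ^ n)
  poly-^ zero    p = poly-const 1#
  poly-^ (suc n) p = poly-* p (poly-^ n p)

  poly-∑ : ∀ n {g : ℕ → Vector Carrier n} → (∀ i → IsPoly (λ b → g b i)) → IsPoly (λ b → sum (g b))
  poly-∑ zero    p = poly-const 0#
  poly-∑ (suc n) p = poly-+ (p Fin.zero) (poly-∑ n (p ∘ Fin.suc))

  poly-∏ : ∀ n {g : ℕ → Vector Carrier n} → (∀ i → IsPoly (λ b → g b i)) → IsPoly (λ b → prod (g b))
  poly-∏ zero    p = poly-const 1#
  poly-∏ (suc n) p = poly-* (p Fin.zero) (poly-∏ n (p ∘ Fin.suc))

  IsPolyₛ : (ℕ → FPS) → Set (c ⊔ r)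
  IsPolyₛ F = ∀ n → IsPoly (λ b → F b n)

  poly-⊛ : ∀ {F H} → IsPolyₛ F → IsPolyₛ H → IsPolyₛ (λ b → F b ⊛ H b)
  poly-⊛ p q n = poly-∑ (suc n) λ i → poly-* (p (toℕ i)) (q (n ∸ toℕ i))

  poly-⊛^ : ∀ {F} n → IsPolyₛ F → IsPolyₛ (λ b → F b ⊛^ n)
  poly-⊛^ zero    p n = poly-const (1ₛ n)
  poly-⊛^ (suc i) p = poly-⊛ p (poly-⊛^ i p)

  poly-∏ₛ : ∀ k {F : ℕ → Vector FPS k} → (∀ i → IsPolyₛ (λ b → F b i)) → IsPolyₛ (λ b → ∏ₛ (F b))
  poly-∏ₛ zero    p n = poly-const (1ₛ n)
  poly-∏ₛ (suc k) p = poly-⊛ (p Fin.zero) (poly-∏ₛ k (p ∘ Fin.suc))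

  poly-⟨⟩ : ∀ {F H} → IsPolyₛ F → IsPolyₛ H → IsPolyₛ (λ b → F b ⟨ H b ⟩)
  poly-⟨⟩ p q n = poly-∑ (suc n) λ i → poly-* (p (toℕ i)) (poly-⊛^ (toℕ i) q n)

  poly-∫₀ : ∀ {F} → IsPolyₛ F → IsPolyₛ (λ b → ∫₀ (F b))
  poly-∫₀ p zero    = poly-const 0#
  poly-∫₀ p (suc n) = poly-* (poly-const (recip (suc n))) (p n)

  poly-b-m : ∀ m → IsPoly (λ b → fromℕ b - fromℕ m)
  poly-b-m m = poly-+ poly-fromℕ (poly-const (- fromℕ m))

  poly-J : IsPolyₛ J
  poly-J zero    = poly-const 0#
  poly-J (suc q) = poly-* (poly-const _) (poly-∏ q λ m →
    poly-* (poly-b-m (toℕ m)) (poly-+ (poly-b-m (toℕ m)) (poly-const (- 1#))))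

  poly-I : ∀ j → IsPolyₛ (λ b → I b (b ℕ.+ j))
  poly-I j p = poly-* (poly-const _) (poly-∏ p λ m →
    poly-+ (poly-^ 2 (poly-resp (λ b → fromℕ-+ b j) (poly-+ poly-fromℕ (poly-const (fromℕ j)))))
      (poly-neg (poly-^ 2 (poly-b-m (toℕ m)))))

  poly-fromRoots : ∀ {p} {a : ℕ → Vector Carrier p} → (∀ m → IsPoly (λ b → a b m)) →
    IsPolyₛ (λ b → fromRoots (a b))
  poly-fromRoots {zero}  pa q       = poly-const (1ₛ q)
  poly-fromRoots {suc p} pa zero    =
    poly-* (poly-neg (pa Fin.zero)) (poly-fromRoots (pa ∘ Fin.suc) 0)
  poly-fromRoots {suc p} pa (suc q) =
    poly-+ (poly-fromRoots (pa ∘ Fin.suc) q)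
      (poly-* (poly-neg (pa Fin.zero)) (poly-fromRoots (pa ∘ Fin.suc) (suc q)))

  poly-G : ∀ q → IsPolyₛ (λ b → G b q)
  poly-G q p = poly-* (poly-const _) (poly-fromRoots {p} (λ m → poly-^ 2 (poly-b-m (toℕ m))) q)

  IsPoly∞ : (ℕ → FPS∞) → Set (c ⊔ r)
  IsPoly∞ F = ∀ e → IsPoly (λ b → F b e)

  poly-⊛∞ : ∀ F H → IsPoly∞ F → IsPoly∞ H → IsPoly∞ (λ b → F b ⊛∞ H b)
  poly-⊛∞ F H p q []       = poly-* (p []) (q [])
  poly-⊛∞ F H p q (e ∷ es) = poly-∑ (suc e) λ i →
    poly-⊛∞ (λ b → F b ∘ (toℕ i ∷_)) (λ b → H b ∘ (e ∸ toℕ i ∷_))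
      (λ es → p (toℕ i ∷ es)) (λ es → q (e ∸ toℕ i ∷ es)) es

  poly-⊛∞^ : ∀ F n → IsPoly∞ F → IsPoly∞ (λ b → F b ⊛∞^ n)
  poly-⊛∞^ F zero    p e = poly-const (1∞ e)
  poly-⊛∞^ F (suc n) p = poly-⊛∞ F (λ b → F b ⊛∞^ n) p (poly-⊛∞^ F n p)

  poly-⟨⟩∞ : ∀ f F → IsPolyₛ f → IsPoly∞ F → IsPoly∞ (λ b → f b ⟨ F b ⟩∞)
  poly-⟨⟩∞ f F p q e = poly-∑ (suc (lsum e)) λ i → poly-* (p (toℕ i)) (poly-⊛∞^ F (toℕ i) q e)

  poly-y : ∀ j F → IsPoly∞ F → IsPoly∞ (λ b → y[ j ]· F b)
  poly-y j       F p []           = poly-const 0#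
  poly-y zero    F p (zero  ∷ es) = poly-const 0#
  poly-y zero    F p (suc e ∷ es) = p (e ∷ es)
  poly-y (suc j) F p (e ∷ es)     = poly-y j (λ b → F b ∘ (e ∷_)) (λ es → p (e ∷ es)) es

  module _ {Ψ : ℕ → FPS} (Ψ₀ : ∀ b → Ψ b 0 ≈ 0#) (Ψ₁ : ∀ b → Ψ b 1 ≈ 1#) {φ : ℕ → ℕ → FPS}
    (Ψ-poly : IsPolyₛ Ψ) (φ-poly : ∀ j → IsPolyₛ (λ b → φ b j)) where

    private
      module FP b = FixedPoint (Ψ b) (Ψ₀ b) (Ψ₁ b) (φ b)

    poly-iter : ∀ n → IsPoly∞ (λ b → FP.iter b n)
    poly-iter zero    e = poly-const 0#
    poly-iter (suc n) e = poly-+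
      (poly-∑ (length e) λ j → poly-y (toℕ j) (λ b → φ b (toℕ j) ⟨ F b ⟩∞)
        (poly-⟨⟩∞ (λ b → φ b (toℕ j)) F (φ-poly (toℕ j)) (poly-iter n)) e)
      (poly-neg (poly-⊛∞ F (λ b → F b ⊛∞ tail (tail (Ψ b)) ⟨ F b ⟩∞) (poly-iter n)
        (poly-⊛∞ F (λ b → tail (tail (Ψ b)) ⟨ F b ⟩∞) (poly-iter n)
          (poly-⟨⟩∞ (λ b → tail (tail (Ψ b))) F (λ m → Ψ-poly (suc (suc m))) (poly-iter n))) e))
      where
      F : ℕ → FPS∞
      F b = FP.iter b n

    poly-solution : IsPoly∞ (λ b → FP.solution b)
    poly-solution e = poly-iter (suc (lsum e)) e

  -- Order in r and leading coefficients

  Val : ℕ → FPS → Set r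
  Val m F = ∀ n → n < m → F n ≈ 0#

  val-⊛ : ∀ {m n F H} → Val m F → Val n H → Val (m ℕ.+ n) (F ⊛ H)
  val-⊛ {m} {n} {F} {H} F-val H-val s s< = ∑-zero (suc s) λ i → go (toℕ i) (Finₚ.toℕ≤pred[n] i)
    where
    go : ∀ i → i ≤ s → F i * H (s ∸ i) ≈ 0#
    go i i≤s with i ℕₚ.<? m
    ... | yes i<m = ≈-trans (*-congʳ (F-val i i<m)) (zeroˡ _)
    ... | no  i≮m = ≈-trans (*-congˡ (H-val (s ∸ i) (ℕₚ.+-cancelˡ-< i _ _
      (≡.subst (_< i ℕ.+ n) (≡.sym (ℕₚ.m+[n∸m]≡n i≤s))
        (ℕₚ.<-≤-trans s< (ℕₚ.+-monoˡ-≤ n (ℕₚ.≮⇒≥ i≮m))))))) (zeroʳ _)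

  lead-⊛ : ∀ {m n F H} → Val m F → Val n H → (F ⊛ H) (m ℕ.+ n) ≈ F m * H n
  lead-⊛ {m} {n} {F} {H} F-val H-val = ≈-trans
    (∑-single (λ i → F i * H (m ℕ.+ n ∸ i)) m (s≤s (ℕₚ.m≤m+n m n)) λ i i≤ i≢m → go i i≤ (ℕₚ.<-cmp i m) i≢m)
    (*-congˡ (reflexive (≡.cong H (ℕₚ.m+n∸m≡n m n))))
    where
    go : ∀ i → i < suc (m ℕ.+ n) → Tri (i < m) (i ≡ m) (m < i) → i ≢ m → F i * H (m ℕ.+ n ∸ i) ≈ 0#
    go i _  (tri< i<m _ _) _   = ≈-trans (*-congʳ (F-val i i<m)) (zeroˡ _)
    go i _  (tri≈ _ i≡m _) i≢m = contradiction i≡m i≢m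
    go i i< (tri> _ _ m<i) _   = ≈-trans (*-congˡ (H-val _ (≡.subst (m ℕ.+ n ∸ i <_) (ℕₚ.m+n∸m≡n m n)
      (ℕₚ.∸-monoʳ-< m<i (ℕₚ.≤-pred i<))))) (zeroʳ _)

  IsUnit : Carrier → Set (c ⊔ r)
  IsUnit a = Σ[ a′ ∈ Carrier ] a′ * a ≈ 1#

  unit-resp : ∀ {a b} → a ≈ b → IsUnit a → IsUnit b
  unit-resp a≈b (a′ , p) = a′ , ≈-trans (*-congˡ (≈-sym a≈b)) p

  unit-1 : IsUnit 1#
  unit-1 = 1# , *-identityˡ 1#

  unit-* : ∀ {a b} → IsUnit a → IsUnit b → IsUnit (a * b)
  unit-* (a′ , p) (b′ , q) = a′ * b′ , ≈-trans
    (CommutativeSemigroupProperties.interchange *-commutativeSemigroup _ _ _ _)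
    (≈-trans (*-cong p q) (*-identityˡ 1#))

  unit-recip : ∀ n → .{{_ : ℕ.NonZero n}} → IsUnit (recip n)
  unit-recip n = fromℕ n , proj₂ (proj₂ (inv n))

  unit-fromℕ : ∀ n → .{{_ : ℕ.NonZero n}} → IsUnit (fromℕ n)
  unit-fromℕ n = recip n , proj₁ (proj₂ (inv n))

  unit-cancel : ∀ {a x} → IsUnit a → a * x ≈ 0# → x ≈ 0#
  unit-cancel {a} {x} (a′ , p) ax≈0 = begin
    x            ≈⟨ *-identityˡ x ⟨
    1# * x       ≈⟨ *-congʳ p ⟨
    a′ * a * x   ≈⟨ *-assoc _ _ _ ⟩
    a′ * (a * x) ≈⟨ *-congˡ ax≈0 ⟩
    a′ * 0#      ≈⟨ zeroʳ a′ ⟩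
    0# ∎

  G-val : ∀ b q → Val q (G b q)
  G-val b q p p<q = ≈-trans (*-congˡ (fromRoots-vanish {p} _ q p<q)) (zeroʳ _)

  G-lead : ∀ b q → IsUnit (G b q q)
  G-lead b q = unit-* (unit-* u u) (unit-resp (≈-sym (fromRoots-monic {q} _)) unit-1)
    where u = unit-recip (q !) {{q ℕₚ.!≢0}}

  ∏G-val : ∀ {m} b (e : Vec ℕ m) → Val (Vec.sum e) (∏ₑ (G b) e)
  ∏G-val b []      n ()
  ∏G-val b (q ∷ e) = val-⊛ (G-val b q) (∏G-val b e)

  ∏G-lead : ∀ {m} b (e : Vec ℕ m) → IsUnit (∏ₑ (G b) e (Vec.sum e))
  ∏G-lead b []      = unit-1
  ∏G-lead b (q ∷ e) = unit-resp (≈-sym (lead-⊛ (G-val b q) (∏G-val b e)))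
    (unit-* (G-lead b q) (∏G-lead b e))

  J₁ : ∀ b → J b 1 ≈ 1#
  J₁ b = begin
    - 1# * (- 1# * 1#) * recip! 1 * recip! 0 * 1#
      ≈⟨ *-identityʳ _ ⟩
    - 1# * (- 1# * 1#) * recip! 1 * recip! 0
      ≈⟨ *-cong (*-cong (≈-trans (RingProperties.-1*x≈-x ring _) (≈-trans (-‿cong (*-identityʳ _))
           (AbelianGroupProperties.⁻¹-involutive +-abelianGroup 1#))) one) one ⟩
    1# * 1# * 1#
      ≈⟨ ≈-trans (*-identityʳ _) (*-identityʳ _) ⟩
    1# ∎
    where
    one : recip 1 ≈ 1#
    one = ≈-trans (≈-sym (*-identityʳ _)) (≈-trans (*-congˡ (≈-sym (+-identityʳ 1#))) (proj₁ (proj₂ (inv 1))))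

  module Lag b = Lagrange (J b) ≈-refl (J₁ b) (λ j → I b (b ℕ.+ j))

  Jinv : ℕ → FPS
  Jinv b = restrict 0 (Lag.W b)

  poly-Jinv : IsPolyₛ Jinv
  poly-Jinv n = poly-solution (λ _ → ≈-refl) J₁ {λ b → Lag.ψ b} poly-J ψ-poly (n ∷ [])
    where
    ψ-poly : ∀ j → IsPolyₛ (λ b → Lag.ψ b j)
    ψ-poly zero    n = poly-const (1ₛ n)
    ψ-poly (suc j) = poly-I j

  Jinv-val : ∀ b → Val 1 (Jinv b)
  Jinv-val b zero _ = Lag.solution-ZeroConst b (0 ∷ []) ≡.refl (s≤s z≤n)
  Jinv-val b (suc n) (s≤s ())

  Jinv-lead : ∀ b → Jinv b 1 ≈ 1#
  Jinv-lead b = begin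
    g 1
      ≈⟨ CommutativeRing.*-identityʳ FPS-ring g 1 ⟨
    (g ⊛ 1ₛ) 1
      ≈⟨ ≈-trans (*-congʳ (J₁ b)) (*-identityˡ _) ⟨
    J b 1 * (g ⊛ 1ₛ) 1
      ≈⟨ ≈-trans (+-cong (zeroʳ _) (+-identityʳ _)) (+-identityˡ _) ⟨
    (J b ⟨ g ⟩) 1
      ≈⟨ Lag.restrict-inverse b 0 1 ⟩
    1# ∎
    where g = Jinv b

  module Functional (f : FPS) (d : ℕ) (g : FPS) where

    open Box d

    Λ : FPS → Carrier
    Λ H = fromℕ (suc d !) * (∫₀ (deriv f ⊛ H) ⟨ g ⟩) (suc d)

    private
      coefficient : ∀ H → (∫₀ (deriv f ⊛ H) ⟨ g ⟩) (suc d) ≈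
        ∑[ i ≤ d ] (recip (suc (toℕ i)) * (g ⊛^ suc (toℕ i)) (suc d) * (deriv f ⊛ H) (toℕ i))
      coefficient H = ≈-trans
        (≈-trans (+-congʳ (zeroˡ _)) (+-identityˡ _))
        (∑-cong (suc d) λ i → *-rightComm (recip (suc (toℕ i))) ((deriv f ⊛ H) (toℕ i)) ((g ⊛^ suc (toℕ i)) (suc d)))
        where
        *-rightComm : ∀ x y z → x * y * z ≈ x * z * y
        *-rightComm = CommutativeSemigroupProperties.xy∙z≈xz∙y *-commutativeSemigroup

      ∑-∑B : ∀ {m} n (w : Vector Carrier n) (x : Vec ℕ m → Carrier) (t : Fin n → Vec ℕ m → Carrier) →
        ∑[ i < n ] (w i * ∑B (λ e → x e * t i e)) ≈ ∑B (λ e → x e * ∑[ i < n ] (w i * t i e))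
      ∑-∑B n w x t = begin
        ∑[ i < n ] (w i * ∑B (λ e → x e * t i e))
          ≈⟨ ∑-cong n (λ i → ≈-trans (∑B-distribˡ (w i) (λ e → x e * t i e))
               (∑B-cong λ e → x∙yz≈y∙xz (w i) (x e) (t i e))) ⟩
        ∑[ i < n ] ∑B (λ e → x e * (w i * t i e))
          ≈⟨ ∑B-∑ n (λ e i → x e * (w i * t i e)) ⟩
        ∑B (λ e → ∑[ i < n ] (x e * (w i * t i e)))
          ≈⟨ ∑B-cong (λ e → *-distribˡ-sum {n} (x e) (λ i → w i * t i e)) ⟨
        ∑B (λ e → x e * ∑[ i < n ] (w i * t i e)) ∎

    Λ-cong : ∀ {H H′} → (∀ n → n ≤ d → H n ≈ H′ n) → Λ H ≈ Λ H′
    Λ-cong {H} {H′} p = *-congˡ (≈-trans (coefficient H) (≈-trans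
      (∑-cong (suc d) λ i → *-congˡ {recip (suc (toℕ i)) * (g ⊛^ suc (toℕ i)) (suc d)}
        (∑-cong (suc (toℕ i)) λ a → *-congˡ {deriv f (toℕ a)}
          (p (toℕ i ∸ toℕ a) (ℕₚ.≤-trans (ℕₚ.m∸n≤m (toℕ i) (toℕ a)) (Finₚ.toℕ≤pred[n] i)))))
      (≈-sym (coefficient H′))))

    Λ-∑B : ∀ {m} H (x : Vec ℕ m → Carrier) (P : Vec ℕ m → FPS) →
      (∀ n → n ≤ d → H n ≈ ∑B (λ e → x e * P e n)) → Λ H ≈ ∑B (λ e → x e * Λ (P e))
    Λ-∑B H x P p = begin
      Λ H
        ≈⟨ Λ-cong p ⟩
      fromℕ (suc d !) * (∫₀ (deriv f ⊛ (λ n → ∑B (λ e → x e * P e n))) ⟨ g ⟩) (suc d)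
        ≈⟨ *-congˡ (coefficient (λ n → ∑B (λ e → x e * P e n))) ⟩
      fromℕ (suc d !) * ∑[ i ≤ d ] (w i * (deriv f ⊛ (λ n → ∑B (λ e → x e * P e n))) (toℕ i))
        ≈⟨ *-congˡ (∑-cong (suc d) λ i → *-congˡ {w i}
             (∑-∑B (suc (toℕ i)) (λ a → deriv f (toℕ a)) x λ a e → P e (toℕ i ∸ toℕ a))) ⟩
      fromℕ (suc d !) * ∑[ i ≤ d ] (w i * ∑B (λ e → x e * (deriv f ⊛ P e) (toℕ i)))
        ≈⟨ *-congˡ (∑-∑B (suc d) w x λ i e → (deriv f ⊛ P e) (toℕ i)) ⟩
      fromℕ (suc d !) * ∑B (λ e → x e * ∑[ i ≤ d ] (w i * (deriv f ⊛ P e) (toℕ i)))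
        ≈⟨ *-congˡ (∑B-cong λ e → *-congˡ {x e} (coefficient (P e))) ⟨
      fromℕ (suc d !) * ∑B (λ e → x e * (∫₀ (deriv f ⊛ P e) ⟨ g ⟩) (suc d))
        ≈⟨ ∑B-distribˡ (fromℕ (suc d !)) (λ e → x e * (∫₀ (deriv f ⊛ P e) ⟨ g ⟩) (suc d)) ⟩
      ∑B (λ e → fromℕ (suc d !) * (x e * (∫₀ (deriv f ⊛ P e) ⟨ g ⟩) (suc d)))
        ≈⟨ ∑B-cong (λ e → x∙yz≈y∙xz (fromℕ (suc d !)) (x e) ((∫₀ (deriv f ⊛ P e) ⟨ g ⟩) (suc d))) ⟩
      ∑B (λ e → x e * Λ (P e)) ∎
      where
      w : Vector Carrier (suc d)
      w i = recip (suc (toℕ i)) * (g ⊛^ suc (toℕ i)) (suc d)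

    Λ-vanish : ∀ {m H} → d < m → Val m H → Λ H ≈ 0#
    Λ-vanish {H = H} d<m H-val = ≈-trans
      (*-congˡ (≈-trans (coefficient H) (∑-zero (suc d) λ i → ≈-trans
        (*-congˡ {recip (suc (toℕ i)) * (g ⊛^ suc (toℕ i)) (suc d)}
          (val-⊛ {0} {F = deriv f} (λ _ ()) H-val (toℕ i) (ℕₚ.≤-<-trans (Finₚ.toℕ≤pred[n] i) d<m)))
        (zeroʳ _))))
      (zeroʳ _)

    ^-val : ∀ n → Val 1 g → Val n (g ⊛^ n)
    ^-val zero    g-val n ()
    ^-val (suc n) g-val = val-⊛ g-val (^-val n g-val)

    ^-lead : ∀ n → Val 1 g → g 1 ≈ 1# → (g ⊛^ n) n ≈ 1#
    ^-lead zero    g-val g₁ = ≈-refl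
    ^-lead (suc n) g-val g₁ = ≈-trans (lead-⊛ g-val (^-val n g-val))
      (≈-trans (*-cong g₁ (^-lead n g-val g₁)) (*-identityˡ 1#))

    Λ-lead : ∀ {H} → Val 1 g → g 1 ≈ 1# → Val d H → IsUnit (H d) → Λ H ≈ 0# → deriv f 0 ≈ 0#
    Λ-lead {H} g-val g₁ H-val H-lead Λ≈0 =
      unit-cancel H-lead (≈-trans (*-comm _ _)
        (≈-trans (≈-sym (lead-⊛ {0} {F = deriv f} (λ _ ()) H-val))
          (unit-cancel (unit-* (unit-recip (suc d)) (unit-resp (≈-sym (^-lead (suc d) g-val g₁)) unit-1))
            (≈-trans (≈-sym top) (unit-cancel (unit-fromℕ (suc d !) {{suc d ℕₚ.!≢0}}) Λ≈0)))))
      where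
      top : (∫₀ (deriv f ⊛ H) ⟨ g ⟩) (suc d) ≈ recip (suc d) * (g ⊛^ suc d) (suc d) * (deriv f ⊛ H) d
      top = ≈-trans (coefficient H)
        (∑-single (λ i → recip (suc i) * (g ⊛^ suc i) (suc d) * (deriv f ⊛ H) i) d ℕₚ.≤-refl
          λ i i<1+d i≢d → ≈-trans (*-congˡ (val-⊛ {0} {F = deriv f} (λ _ ()) H-val i
            (ℕₚ.≤∧≢⇒< (ℕₚ.≤-pred i<1+d) i≢d))) (zeroʳ _))

  δ : ℕ → ℕ → ℕ
  δ zero    zero    = 1
  δ zero    (suc q) = 0
  δ (suc x) zero    = 0
  δ (suc x) (suc q) = δ x q

  multiplicity : ∀ {m} → Vec ℕ m → ℕ → ℕ
  multiplicity e q = ℕSum.sum (λ i → δ (Vec.lookup e i) q)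

  -- The multiplicities determine ∏ₑ A e, but unlike e they are invariant
  -- under permutations.
  multiplicities : ∀ {m} n → Vec ℕ m → Vec ℕ n
  multiplicities n e = Vec.tabulate {n = n} (λ q → multiplicity e (toℕ q))

  permute : ∀ {m} → Permutation′ m → Vec ℕ m → Vec ℕ m
  permute π e = Vec.tabulate (λ i → Vec.lookup e (π ⟨$⟩ʳ i))

  multiplicities-permute : ∀ {m} n (e : Vec ℕ m) π →
    multiplicities n (permute π e) ≡ multiplicities n e
  multiplicities-permute n e π = Vecₚ.tabulate-cong λ q → ≡.trans
    (ℕSum.sum-cong-≗ λ i → ≡.cong (λ x → δ x (toℕ q)) (Vecₚ.lookup∘tabulate (λ i → Vec.lookup e (π ⟨$⟩ʳ i)) i))
    (≡.sym (ℕSum.sum-permute (λ i → δ (Vec.lookup e i) (toℕ q)) π))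

  sum-lookup : ∀ {m} (e : Vec ℕ m) → Vec.sum e ≡ ℕSum.sum (Vec.lookup e)
  sum-lookup []      = ≡.refl
  sum-lookup (q ∷ e) = ≡.cong (q ℕ.+_) (sum-lookup e)

  sum-permute-vec : ∀ {m} (e : Vec ℕ m) π → Vec.sum (permute π e) ≡ Vec.sum e
  sum-permute-vec e π = ≡.trans (sum-lookup (permute π e)) (≡.trans
    (ℕSum.sum-cong-≗ (Vecₚ.lookup∘tabulate (λ i → Vec.lookup e (π ⟨$⟩ʳ i))))
    (≡.trans (≡.sym (ℕSum.sum-permute (Vec.lookup e) π)) (≡.sym (sum-lookup e))))

  ∏ₘ : ∀ {n} → (ℕ → FPS) → Vec ℕ n → FPS
  ∏ₘ A v = ∏ₛ (λ q → A (toℕ q) ⊛^ Vec.lookup v q)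

  module _ where
    private
      module FPS = CommutativeRing FPS-ring

    ∏-δ : ∀ n (A : ℕ → FPS) x (t : ℕ → ℕ) → x < n →
      ∏ₛ {n} (λ q → A (toℕ q) ⊛^ (δ x (toℕ q) ℕ.+ t (toℕ q))) ≋ₛ A x ⊛ ∏ₛ {n} (λ q → A (toℕ q) ⊛^ t (toℕ q))
    ∏-δ (suc n) A zero    t _ =
      FPS.*-assoc (A 0) (A 0 ⊛^ t 0) (∏ₛ {n} (λ q → A (suc (toℕ q)) ⊛^ t (suc (toℕ q))))
    ∏-δ (suc n) A (suc x) t (s≤s x<n) = FPS.trans
      (FPS.*-congˡ {A 0 ⊛^ t 0} (∏-δ n (A ∘ suc) x (t ∘ suc) x<n))
      (CommutativeSemigroupProperties.x∙yz≈y∙xz FPS.*-commutativeSemigroup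
        (A 0 ⊛^ t 0) (A (suc x)) (∏ₛ {n} (λ q → A (suc (toℕ q)) ⊛^ t (suc (toℕ q)))))

    ∏-1ₛ : ∀ n → ∏ₛ {n} (λ _ → 1ₛ) ≋ₛ 1ₛ
    ∏-1ₛ zero    = FPS.refl
    ∏-1ₛ (suc n) = FPS.trans (FPS.*-identityˡ (∏ₛ {n} (λ _ → 1ₛ))) (∏-1ₛ n)

    ∏-multiplicity : ∀ {m} n (A : ℕ → FPS) (e : Vec ℕ m) → Vec.sum e < n →
      ∏ₛ {n} (λ q → A (toℕ q) ⊛^ multiplicity e (toℕ q)) ≋ₛ ∏ₑ A e
    ∏-multiplicity n A []      s = ∏-1ₛ n
    ∏-multiplicity n A (x ∷ e) s = FPS.trans
      (∏-δ n A x (multiplicity e) (ℕₚ.≤-<-trans (ℕₚ.m≤m+n x _) s))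
      (FPS.*-congˡ {A x} (∏-multiplicity n A e (ℕₚ.≤-<-trans (ℕₚ.m≤n+m _ x) s)))

    ∏ₘ-multiplicities : ∀ {m} n (A : ℕ → FPS) (e : Vec ℕ m) → Vec.sum e < n →
      ∏ₘ A (multiplicities n e) ≋ₛ ∏ₑ A e
    ∏ₘ-multiplicities n A e s = FPS.trans
      (∏ₛ-cong {n} λ q → FPS.reflexive (≡.cong (A (toℕ q) ⊛^_)
        (Vecₚ.lookup∘tabulate (λ q → multiplicity e (toℕ q)) q)))
      (∏-multiplicity n A e s)

  -- The polynomial

  eval-++ : ∀ {n} (P Q : Polynomial n) x → eval (P List.++ Q) x ≈ eval P x + eval Q x
  eval-++ []      Q x = ≈-sym (+-identityˡ _)
  eval-++ (_ ∷ P) Q x = ≈-trans (+-congˡ (eval-++ P Q x)) (≈-sym (+-assoc _ _ _))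

  coeff-++ : ∀ {n} (P Q : Polynomial n) e → coeff (P List.++ Q) e ≈ coeff P e + coeff Q e
  coeff-++ []      Q e = ≈-sym (+-identityˡ _)
  coeff-++ (_ ∷ P) Q e = ≈-trans (+-congˡ (coeff-++ P Q e)) (≈-sym (+-assoc _ _ _))

  terms : ∀ {m} → ℕ → List Carrier → Vec ℕ m → Polynomial (suc m)
  terms a []       e = []
  terms a (z ∷ zs) e = (z , a ∷ e) ∷ terms (suc a) zs e

  eval-terms : ∀ {m} a zs (e : Vec ℕ m) β x →
    eval (terms a zs e) (β Vector.∷ x) ≈ β ^ a * (polyEval zs β * monomial x e)
  eval-terms a []       e β x = ≈-sym (≈-trans (*-congˡ (zeroˡ _)) (zeroʳ _))
  eval-terms a (z ∷ zs) e β x = begin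
    z * (β ^ a * X) + eval (terms (suc a) zs e) (β Vector.∷ x)
      ≈⟨ +-cong (x∙yz≈y∙xz _ _ _) (eval-terms (suc a) zs e β x) ⟩
    β ^ a * (z * X) + β * β ^ a * (polyEval zs β * X)
      ≈⟨ +-congˡ (≈-trans (*-congʳ (*-comm _ _)) (≈-trans (*-assoc _ _ _) (*-congˡ (≈-sym (*-assoc _ _ _))))) ⟩
    β ^ a * (z * X) + β ^ a * (β * polyEval zs β * X)
      ≈⟨ distribˡ _ _ _ ⟨
    β ^ a * (z * X + β * polyEval zs β * X)
      ≈⟨ *-congˡ (distribʳ _ _ _) ⟨
    β ^ a * ((z + β * polyEval zs β) * X) ∎
    where X = monomial x e

  coeff-terms-≢ : ∀ {m} a zs (e e′ : Vec ℕ m) a′ → e ≢ e′ → coeff (terms a zs e) (a′ ∷ e′) ≈ 0#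
  coeff-terms-≢ a []       e e′ a′ e≢e′ = ≈-refl
  coeff-terms-≢ a (z ∷ zs) e e′ a′ e≢e′ = ≈-trans
    (+-cong (reflexive (≡.cong (if_then z else 0#)
      (dec-false (Vecₚ.≡-dec ℕₚ._≟_ (a ∷ e) (a′ ∷ e′)) (e≢e′ ∘ Vecₚ.∷-injectiveʳ))))
      (coeff-terms-≢ (suc a) zs e e′ a′ e≢e′))
    (+-identityˡ 0#)

  coeff₁ : ℕ → List Carrier → ℕ → Carrier
  coeff₁ a []       a′ = 0#
  coeff₁ a (z ∷ zs) a′ = (if does (a ℕₚ.≟ a′) then z else 0#) + coeff₁ (suc a) zs a′

  coeff-terms : ∀ {m} a zs (e : Vec ℕ m) a′ → coeff (terms a zs e) (a′ ∷ e) ≈ coeff₁ a zs a′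
  coeff-terms a []       e a′ = ≈-refl
  coeff-terms a (z ∷ zs) e a′ =
    +-cong (reflexive (≡.cong (if_then z else 0#) (same (a ℕₚ.≟ a′)))) (coeff-terms (suc a) zs e a′)
    where
    same : (a≟a′ : Dec (a ≡ a′)) → does (Vecₚ.≡-dec ℕₚ._≟_ (a ∷ e) (a′ ∷ e)) ≡ does a≟a′
    same (yes ≡.refl) = dec-true (Vecₚ.≡-dec ℕₚ._≟_ (a ∷ e) (a ∷ e)) ≡.refl
    same (no a≢a′)    = dec-false (Vecₚ.≡-dec ℕₚ._≟_ (a ∷ e) (a′ ∷ e)) (a≢a′ ∘ Vecₚ.∷-injectiveˡ)

  coeff₁-0 : ∀ zs → coeff₁ 0 zs 0 ≈ polyEval zs 0#
  coeff₁-0 []       = ≈-refl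
  coeff₁-0 (z ∷ zs) = +-congˡ (≈-trans (high 0 zs) (≈-sym (zeroˡ _)))
    where
    high : ∀ a zs → coeff₁ (suc a) zs 0 ≈ 0#
    high a []       = ≈-refl
    high a (_ ∷ zs) = ≈-trans (+-identityˡ _) (high (suc a) zs)

  module Result (f : FPS) (d : ℕ) where

    open Box d
    open Functional f d

    private
      k = suc d

    polyBox : ∀ {m n} → (Vec ℕ m → Polynomial n) → Polynomial n
    polyBox {zero}  t = t []
    polyBox {suc m} t = Vector.foldr List._++_ [] {suc d} (λ q → polyBox (λ e → t (toℕ q ∷ e)))

    polyBox-hom : ∀ {m n} (h : Polynomial n → Carrier) → h [] ≈ 0# →
      (∀ P Q → h (P List.++ Q) ≈ h P + h Q) → (t : Vec ℕ m → Polynomial n) →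
      h (polyBox t) ≈ ∑B (λ e → h (t e))
    polyBox-hom {zero}  h h-[] h-++ t = ≈-refl
    polyBox-hom {suc m} {n} h h-[] h-++ t = ≈-trans
      (go (suc d) (λ q → polyBox (λ e → t (toℕ q ∷ e))))
      (∑-cong (suc d) λ q → polyBox-hom h h-[] h-++ (λ e → t (toℕ q ∷ e)))
      where
      go : ∀ l (u : Vector (Polynomial n) l) → h (Vector.foldr List._++_ [] u) ≈ sum (h ∘ u)
      go zero    u = h-[]
      go (suc l) u = ≈-trans (h-++ _ _) (+-congˡ (go l (u ∘ Fin.suc)))

    C : Vec ℕ k → ℕ → Carrier
    C v b = Λ (Jinv b) (∏ₘ (G b) v)

    poly-C : ∀ v → IsPoly (C v)
    poly-C v = poly-* (poly-const _) (poly-⟨⟩ (poly-∫₀ (poly-⊛ (λ n → poly-const (deriv f n))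
      (poly-∏ₛ k λ q → poly-⊛^ (Vec.lookup v q) (poly-G (toℕ q))))) poly-Jinv k)

    abstract

      C-coefficients : Vec ℕ k → List Carrier
      C-coefficients v = proj₁ (poly-C v)

      C-coefficients-eval : ∀ v b → C v b ≈ polyEval (C-coefficients v) (fromℕ b)
      C-coefficients-eval v = proj₂ (poly-C v)

    coefficients : Vec ℕ k → List Carrier
    coefficients e = C-coefficients (multiplicities k e)

    coefficients-permute : ∀ (e : Vec ℕ k) π → coefficients (permute π e) ≡ coefficients e
    coefficients-permute e π = ≡.cong C-coefficients (multiplicities-permute k e π)

    coefficients-eval : ∀ (e : Vec ℕ k) → Vec.sum e ≤ d → ∀ b →
      polyEval (coefficients e) (fromℕ b) ≈ Λ (Jinv b) (∏ₑ (G b) e)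
    coefficients-eval e s b = ≈-trans (≈-sym (C-coefficients-eval (multiplicities k e) b))
      (Λ-cong (Jinv b) (λ n _ → ∏ₘ-multiplicities k (G b) e (s≤s s) n))

    part : (e : Vec ℕ k) → Dec (Vec.sum e ≤ d) → Polynomial (suc k)
    part e s≤d = if does s≤d then terms 0 (coefficients e) e else []

    P : Polynomial (suc k)
    P = polyBox (λ e → part e (Vec.sum e ℕₚ.≤? d))

    P-eval : ∀ b x → eval P (fromℕ b Vector.∷ x) ≈ ∑B (λ e → monomial x e * Λ (Jinv b) (∏ₑ (G b) e))
    P-eval b x = ≈-trans
      (polyBox-hom (λ P → eval P (fromℕ b Vector.∷ x)) ≈-refl
        (λ P Q → eval-++ P Q (fromℕ b Vector.∷ x)) (λ e → part e (Vec.sum e ℕₚ.≤? d)))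
      (∑B-cong λ e → go e (Vec.sum e ℕₚ.≤? d))
      where
      go : ∀ e s≤d → eval (part e s≤d) (fromℕ b Vector.∷ x) ≈ monomial x e * Λ (Jinv b) (∏ₑ (G b) e)
      go e (yes s≤d) = ≈-trans (eval-terms 0 (coefficients e) e (fromℕ b) x)
        (≈-trans (*-identityˡ _) (≈-trans (*-comm _ _) (*-congˡ (coefficients-eval e s≤d b))))
      go e (no  s≰d) = ≈-sym (≈-trans (*-congˡ (Λ-vanish (Jinv b) (ℕₚ.≰⇒> s≰d) (∏G-val b e))) (zeroʳ _))

    part-off : ∀ a e e′ s≤d → e′ ≢ e → coeff (part e′ s≤d) (a ∷ e) ≈ 0#
    part-off a e e′ (yes _) e′≢e = coeff-terms-≢ 0 (coefficients e′) e′ e a e′≢e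
    part-off a e e′ (no _)  e′≢e = ≈-refl

    P-coeff : ∀ a e → coeff P (a ∷ e) ≈ ∑B (λ e′ → coeff (part e′ (Vec.sum e′ ℕₚ.≤? d)) (a ∷ e))
    P-coeff a e = polyBox-hom (λ P → coeff P (a ∷ e)) ≈-refl (λ P Q → coeff-++ P Q (a ∷ e))
      (λ e → part e (Vec.sum e ℕₚ.≤? d))

    P-coeff-≤ : ∀ a e → Vec.sum e ≤ d → coeff P (a ∷ e) ≈ coeff₁ 0 (coefficients e) a
    P-coeff-≤ a e s = ≈-trans (P-coeff a e) (≈-trans
      (∑B-single (λ e′ → coeff (part e′ (Vec.sum e′ ℕₚ.≤? d)) (a ∷ e)) e s
        λ e′ → part-off a e e′ (Vec.sum e′ ℕₚ.≤? d))
      (go (Vec.sum e ℕₚ.≤? d)))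
      where
      go : ∀ s≤d → coeff (part e s≤d) (a ∷ e) ≈ coeff₁ 0 (coefficients e) a
      go (yes _)  = coeff-terms 0 (coefficients e) e a
      go (no s≰d) = contradiction s s≰d

    P-coeff-> : ∀ a e → d < Vec.sum e → coeff P (a ∷ e) ≈ 0#
    P-coeff-> a e s = ≈-trans (P-coeff a e) 
      (∑B-zero {g = λ e′ → coeff (part e′ (Vec.sum e′ ℕₚ.≤? d)) (a ∷ e)}
        λ e′ → go e′ (Vec.sum e′ ℕₚ.≤? d) (Vecₚ.≡-dec ℕₚ._≟_ e′ e))
      where
      go : ∀ e′ s≤d → Dec (e′ ≡ e) → coeff (part e′ s≤d) (a ∷ e) ≈ 0#
      go e′ s≤d (no e′≢e)        = part-off a e e′ s≤d e′≢e
      go e′ (no _) (yes _)       = ≈-refl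
      go e′ (yes s≤d) (yes ≡.refl) = contradiction s≤d (ℕₚ.<⇒≱ s)

    P-symmetric : SymmetricInTail P
    P-symmetric a e π = go (Vec.sum e ℕₚ.≤? d)
      where
      go : Dec (Vec.sum e ≤ d) → coeff P (a ∷ permute π e) ≈ coeff P (a ∷ e)
      go (yes s≤d) = ≈-trans (P-coeff-≤ a (permute π e) (≡.subst (_≤ d) (≡.sym (sum-permute-vec e π)) s≤d))
          (≈-trans (reflexive (≡.cong (λ zs → coeff₁ 0 zs a) (coefficients-permute e π)))
            (≈-sym (P-coeff-≤ a e s≤d)))
      go (no s≰d) = ≈-trans (P-coeff-> a (permute π e) (≡.subst (d <_) (≡.sym (sum-permute-vec e π)) (ℕₚ.≰⇒> s≰d)))
          (≈-sym (P-coeff-> a e (ℕₚ.≰⇒> s≰d)))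

    P-degree : ¬ (deriv f 0 ≈ 0#) → HasTailDegree P d
    P-degree f′≉0 = P-coeff-> , 0 , e , s , λ c≈0 → f′≉0
      (Λ-lead (Jinv 0) (Jinv-val 0) (Jinv-lead 0)
        (≡.subst (λ s → Val s (∏ₑ (G 0) e)) s (∏G-val 0 e))
        (≡.subst (λ s → IsUnit (∏ₑ (G 0) e s)) s (∏G-lead 0 e))
        (≈-trans (≈-sym (coefficients-eval e s≤d 0)) (≈-trans (≈-sym (coeff₁-0 (coefficients e)))
          (≈-trans (≈-sym (P-coeff-≤ 0 e s≤d)) c≈0))))
      where
      e : Vec ℕ k
      e = d ∷ Vec.replicate d 0
      s : Vec.sum e ≡ d
      s = ≡.trans (≡.cong (d ℕ.+_) (sum-zero d)) (ℕₚ.+-identityʳ d)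
        where
        sum-zero : ∀ n → Vec.sum (Vec.replicate n 0) ≡ 0
        sum-zero zero    = ≡.refl
        sum-zero (suc n) = sum-zero n
      s≤d : Vec.sum e ≤ d
      s≤d = ℕₚ.≤-reflexive s

    integral-P : ∀ b (ℓ : Vector ℕ k) J⁻¹ → IsCompositionalInverse (J b) J⁻¹ →
      fromℕ (k !) * integral b ℓ f J⁻¹ k ≈ eval P (b,ℓ² b ℓ)
    integral-P b ℓ J⁻¹ (J⁻¹₀ , J-J⁻¹ , _) = begin
      fromℕ (k !) * integral b ℓ f J⁻¹ k
        ≈⟨ *-congˡ (⟨⟩ₛ-cong {h} {h} {Jinv b} {J⁻¹} (λ _ → ≈-refl) (Lag.restrict-unique b J⁻¹₀ J-J⁻¹ 0) k) ⟨
      Λ (Jinv b) (∏ₛ (λ i → I b (ℓ i)))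
        ≈⟨ Λ-∑B (Jinv b) (∏ₛ (λ i → I b (ℓ i))) (monomial x) (∏ₑ (G b))
             (∏-expand (G b) x (λ i → I b (ℓ i)) λ i p p≤d → I-expand b (ℓ i) p d p≤d) ⟩
      ∑B (λ e → monomial x e * Λ (Jinv b) (∏ₑ (G b) e))
        ≈⟨ P-eval b x ⟨
      eval P (b,ℓ² b ℓ) ∎
      where
      x : Vector Carrier k
      x i = fromℕ (ℓ i) ^ 2
      h = ∫₀ (deriv f ⊛ ∏ₛ (λ i → I b (ℓ i)))

    derivatives-integral : ∀ b (ℓ : Vector ℕ k) → (∀ i → b ≤ ℓ i) → ∀ J⁻¹ → IsCompositionalInverse (J b) J⁻¹ →
      ∀ R̂ → IsR̂ b R̂ → at0 (∂x̂ b ℓ (f ⟨ R̂ ⟩∞)) ≈ fromℕ (k !) * integral b ℓ f J⁻¹ k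
    derivatives-integral b ℓ b≤ℓ J⁻¹ (J⁻¹₀ , J-J⁻¹ , _) R̂ (R̂-pad , R̂₀ , R̂-eq) = begin
      at0 (∂x̂ b ℓ (f ⟨ R̂ ⟩∞))
        ≈⟨ reflexive (≡.cong (λ F → F []) (∂x̂-∂∂ ℓ)) ⟩
      at0 (∂∂ (λ i → ℓ i ∸ b) (f ⟨ R̂ ⟩∞))
        ≈⟨ Lag.lagrange b (λ i → ℓ i ∸ b) f R̂-pad R̂₀
             (λ e _ → AbelianGroupProperties.x∙y⁻¹≈ε⇒x≈y +-abelianGroup _ _ (R̂-eq e)) J⁻¹₀ J-J⁻¹ ⟩
      fromℕ (k !) * (∫₀ (deriv f ⊛ ∏ₛ (λ i → I b (b ℕ.+ (ℓ i ∸ b)))) ⟨ J⁻¹ ⟩) k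
        ≈⟨ *-congˡ (⟨⟩ₛ-cong (∫₀-cong (⊛ₛ-cong {deriv f} (λ _ → ≈-refl) (∏ₛ-cong {k} λ i n →
             reflexive (≡.cong (λ l → I b l n) (ℕₚ.m+[n∸m]≡n (b≤ℓ i)))))) (λ _ → ≈-refl) k) ⟩
      fromℕ (k !) * integral b ℓ f J⁻¹ k ∎
      where
      ∂x̂-∂∂ : ∀ {m F} (ℓ : Vector ℕ m) → ∂x̂ b ℓ F ≡ ∂∂ (λ i → ℓ i ∸ b) F
      ∂x̂-∂∂ {zero}  ℓ = ≡.refl
      ∂x̂-∂∂ {suc m} ℓ = ≡.cong (∂ (ℓ Fin.zero ∸ b)) (∂x̂-∂∂ (ℓ ∘ Fin.suc))

lemma13 : ∀ {c r} (K : CommutativeRing c r) (inv : PositivesInvertible K) →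
    let open Series K inv in
    (k : ℕ) → 1 ≤ k →
    (f : FPS) → ¬ (deriv f 0 ≈ 0#) →
    Σ[ P ∈ Polynomial (suc k) ]
    SymmetricInTail P ×
    HasTailDegree P (k ∸ 1) ×
    ((b : ℕ) (ℓ : Vector ℕ k) → (∀ i → b ≤ ℓ i) →
    (J⁻¹ : FPS) → IsCompositionalInverse (J b) J⁻¹ →
    ((R̂ : FPS∞) → IsR̂ b R̂ →
    at0 (∂x̂ b ℓ (f ⟨ R̂ ⟩∞)) ≈ fromℕ (k !) * integral b ℓ f J⁻¹ k) ×
    fromℕ (k !) * integral b ℓ f J⁻¹ k ≈ eval P (b,ℓ² b ℓ))
lemma13 K inv (suc d) _ f f′≉0 =
  P , P-symmetric , P-degree f′≉0 , λ b ℓ b≤ℓ J⁻¹ J⁻¹-inv →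
    derivatives-integral b ℓ b≤ℓ J⁻¹ J⁻¹-inv , integral-P b ℓ J⁻¹ J⁻¹-inv
  where
  open Theory K inv
  open Result f d
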